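{- Let $m\ge 1$, let $t_0$ be a vertex of $P(G,g_0)$, and let $t_1,\dots,t_m$ and $\mu$-operations $\nu_1,\dots,\nu_m$ be such that for each $i=1,\dots,m$ the operation $\nu_i$ is applicable to $t_{i-1}$ and $t_i=\nu_i(t_{i-1})$, and for each $i=1,\dots,m-1$ the leading element of $\nu_{i+1}$ equals the new element of $\nu_i$. Then $t_0,t_1,\dots,t_m$ are pairwise distinct vertices of $P(G,g_0)$ and any two of them are adjacent, i.e. they induce a complete subgraph of the graph of $P(G,g_0)$.
   Context: Let $G$ be a finite abelian group of order $D$ with zero element $0$, and let $G^+=G\setminus\{0\}$. For $g_0\in G$, let $T(G,g_0)$ be the set of vectors $t=(t(g))_{g\in G^+}\in\mathbb{Z}_{\ge 0}^{G^+}$ with $\sum_{g\in G^+}t(g)g=g_0$ (sum computed in $G$), where the zero vector is excluded when $g_0=0$. The master corner polyhedron is $P(G,g_0)=\mathrm{conv}\,T(G,g_0)\subset\mathbb{R}^{G^+}$. For $t\in T(G,g_0)$ put $G_t=\{g\in G^+ : t(g)>0\}$. The graph of $P(G,g_0)$ has the vertices of $P(G,g_0)$ as nodes, two vertices being adjacent if the segment joining them is an edge (one-dimensional face) of $P(G,g_0)$. $\mu$-operations: For $t\in T(G,g_0)$ and distinct $h,f\in G_t$ with $t(h)\le t(f)$ and $h+f\neq 0$, the operation $\mu_{h,f}$ is said to be applicable to $t$, and $s=\mu_{h,f}(t)$ is defined by $s(h)=0$, $s(f)=t(f)-t(h)$, $s(h+f)=t(h+f)+t(h)$, and $s(g)=t(g)$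 for all other $g\in G^+$. For $t\in T(G,g_0)$ and $h\in G_t$ with $t(h)>1$ and $t(h)h\neq 0$, the operation $\mu_h$ is applicable to $t$, and $s=\mu_h(t)$ is defined by $s(h)=0$, $s(t(h)h)=t(t(h)h)+1$, and $s(g)=t(g)$ for all other $g\in G^+$. The leading element of $\mu_{h,f}$ and of $\mu_h$ is $h$; the new element of $\mu_{h,f}$ applied to $t$ is $h+f$, and the new element of $\mu_h$ applied to $t$ is $t(h)h$. -}

module Defs where

open import Level using (Level; _⊔_) renaming (suc to lsuc)
open import Algebra.Apartness.Bundles using (HeytingField; HeytingCommutativeRing)
open import Algebra.Bundles using (AbelianGroup; CommutativeRing)
open import Algebra.Core using (Op₁; Op₂)
open import Algebra.Structures using (IsAbelianGroup)
import Algebra.Definitions.RawMonoid as RawMonoidDefs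
open import Data.Fin.Base using (Fin; punchIn)
open import Data.Fin.Properties using (punchInᵢ≢i)
open import Data.Irrelevant using ([_])
open import Data.Nat.Base as ℕ using (ℕ; suc; _∸_)
open import Data.Product.Base using (Σ; ∃; ∃-syntax; _×_; _,_)
open import Data.Refinement using (Refinement; value; _,_)
open import Data.Sum.Base using (_⊎_)
open import Function.Base using (_∘_)
open import Function.Bundles using (_↔_; Inverse)
open import Relation.Binary.Core using (Rel)
open import Relation.Binary.PropositionalEquality.Core using (_≡_; _≢_; sym; trans; cong)
open import Relation.Binary.Structures using (IsStrictPartialOrder)
open import Relation.Nullary.Negation using (¬_)
open import Relation.Unary using (Pred; _∈_; _∩_; _≐_)

-- The real numbers, characterised as the Cauchy complete Archimedean ordered
-- field.  Neither trichotomy nor decidability of the order is assumed, so the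
-- constructive reals qualify as well as the classical ones.

record RealNumbers c ℓ₁ ℓ₂ : Set (lsuc (c ⊔ ℓ₁ ⊔ ℓ₂)) where
  field
    heytingField : HeytingField c ℓ₁ ℓ₂

  open HeytingField heytingField public

  commutativeRing : CommutativeRing c ℓ₁
  commutativeRing = HeytingCommutativeRing.commutativeRing heytingCommutativeRing

  open RawMonoidDefs (CommutativeRing.+-rawMonoid commutativeRing) public
    using (sum) renaming (_×_ to _ℕ×_)

  fromℕ : ℕ → Carrier
  fromℕ n = n ℕ× 1#

  infix 4 _<_ _≤_

  field
    _<_                    : Rel Carrier ℓ₂
    <-isStrictPartialOrder : IsStrictPartialOrder _≈_ _<_
    <⇒#                    : ∀ {x y} → x < y → x # y
    #⇒<                    : ∀ {x y} → x # y → x < y ⊎ y < x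
    +-monoˡ-<              : ∀ {x y} z → x < y → x + z < y + z
    *-pos                  : ∀ {x y} → 0# < x → 0# < y → 0# < x * y
    archimedean            : ∀ x → ∃[ n ] x < fromℕ n

  _≤_ : Rel Carrier ℓ₂
  x ≤ y = ¬ (y < x)

  -- Exchanging i and j gives the other half of |s i - s j| < δ.
  IsCauchy : (ℕ → Carrier) → Set _
  IsCauchy s = ∀ δ → 0# < δ → ∃[ N ] ∀ i j → N ℕ.≤ i → N ℕ.≤ j → s i < s j + δ

  _ConvergesTo_ : (ℕ → Carrier) → Carrier → Set _
  s ConvergesTo l = ∀ δ → 0# < δ →
    ∃[ N ] ∀ i → N ℕ.≤ i → (s i < l + δ) × (l < s i + δ)

  field
    complete : ∀ s → IsCauchy s → ∃[ l ] s ConvergesTo l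

-- The order of the group is suc order⁺, so that order⁺ counts G ∖ {0}.

record FiniteAbelianGroup a : Set (lsuc a) where
  infixl 7 _∙_
  field
    Carrier        : Set a
    _∙_            : Op₂ Carrier
    ε              : Carrier
    _⁻¹            : Op₁ Carrier
    isAbelianGroup : IsAbelianGroup _≡_ _∙_ ε _⁻¹
    order⁺         : ℕ
    enumeration    : Fin (suc order⁺) ↔ Carrier

  abelianGroup : AbelianGroup a a
  abelianGroup = record { isAbelianGroup = isAbelianGroup }

  open RawMonoidDefs (AbelianGroup.rawMonoid abelianGroup) public
    using (sum) renaming (_×_ to _·_)

  G⁺ : Set a
  G⁺ = Refinement Carrier (_≢ ε)

  -- Enumerates G⁺ without repetition, by skipping the index of ε.
  element⁺ : Fin order⁺ → G⁺
  element⁺ i = to (punchIn (from ε) i) , [ nonzero ]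
    where
    open Inverse enumeration
    nonzero : to (punchIn (from ε) i) ≢ ε
    nonzero eq = punchInᵢ≢i (from ε) i
      (trans (sym (strictlyInverseʳ (punchIn (from ε) i))) (cong from eq))

module MasterCorner {c ℓ₁ ℓ₂ a} (ℝ : RealNumbers c ℓ₁ ℓ₂) (G : FiniteAbelianGroup a)
                    (g₀ : FiniteAbelianGroup.Carrier G) where

  open RealNumbers ℝ using (_≈_; _<_; _≤_; _+_; _*_; _-_; 0#; 1#; fromℕ)
    renaming (Carrier to R; sum to ∑)
  open FiniteAbelianGroup G using (_∙_; ε; _·_; G⁺; order⁺; element⁺)
    renaming (Carrier to |G|; sum to ∑ᴳ) public

  Point : Set (a ⊔ c)
  Point = G⁺ → R

  infix 4 _≈ᵖ_

  _≈ᵖ_ : Rel Point (a ⊔ ℓ₁)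
  x ≈ᵖ y = ∀ g → x g ≈ y g

  ⟨_,_⟩ : Point → Point → R
  ⟨ u , x ⟩ = ∑ (λ i → u (element⁺ i) * x (element⁺ i))

  combination : ∀ {n} → (Fin n → R) → (Fin n → Point) → Point
  combination w p g = ∑ (λ i → w i * p i g)

  conv : ∀ {ℓ} → Pred Point ℓ → Pred Point (a ⊔ c ⊔ ℓ₁ ⊔ ℓ₂ ⊔ ℓ)
  conv S x = ∃[ n ] Σ (Fin n → Point) λ p → Σ (Fin n → R) λ w →
    (∀ i → p i ∈ S) × (∀ i → 0# ≤ w i) × (∑ w ≈ 1#) × (x ≈ᵖ combination w p)

  segment : Point → Point → Pred Point (a ⊔ c ⊔ ℓ₁ ⊔ ℓ₂)
  segment x y z = ∃[ r ] (0# ≤ r) × (r ≤ 1#) ×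
    (z ≈ᵖ λ g → (1# - r) * x g + r * y g)

  AffinelyIndependent : ∀ {n} → (Fin n → Point) → Set (a ⊔ c ⊔ ℓ₁)
  AffinelyIndependent {n} p = (w : Fin n → R) → ∑ w ≈ 0# →
    combination w p ≈ᵖ (λ _ → 0#) → ∀ i → w i ≈ 0#

  affineHull : ∀ {n} → (Fin n → Point) → Pred Point (a ⊔ c ⊔ ℓ₁)
  affineHull {n} p x = Σ (Fin n → R) λ w → (∑ w ≈ 1#) × (x ≈ᵖ combination w p)

  HasDimension : ∀ {ℓ} → Pred Point ℓ → ℕ → Set (a ⊔ c ⊔ ℓ₁ ⊔ ℓ)
  HasDimension F d = Σ (Fin (suc d) → Point) λ p →
    (∀ i → p i ∈ F) × AffinelyIndependent p × (∀ x → x ∈ F → x ∈ affineHull p)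

  -- A face is cut out by a valid inequality ⟨ u , x ⟩ ≥ δ.  This admits P itself
  -- (u = 0, δ = 0) and the empty set; the latter has no dimension.
  IsFace : ∀ {ℓ ℓ′} → Pred Point ℓ → Pred Point ℓ′ → Set (a ⊔ c ⊔ ℓ₁ ⊔ ℓ₂ ⊔ ℓ ⊔ ℓ′)
  IsFace P F = Σ Point λ u → Σ R λ δ →
    (∀ x → x ∈ P → δ ≤ ⟨ u , x ⟩) × (F ≐ P ∩ (λ x → ⟨ u , x ⟩ ≈ δ))

  IsFaceOfDimension : ∀ {ℓ ℓ′} → Pred Point ℓ → ℕ → Pred Point ℓ′ →
                      Set (a ⊔ c ⊔ ℓ₁ ⊔ ℓ₂ ⊔ ℓ ⊔ ℓ′)
  IsFaceOfDimension P d F = IsFace P F × HasDimension F d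

  IsVertex : ∀ {ℓ} → Pred Point ℓ → Pred Point (a ⊔ c ⊔ ℓ₁ ⊔ ℓ₂ ⊔ ℓ)
  IsVertex P x = IsFaceOfDimension P 0 (_≈ᵖ x)

  Adjacent : ∀ {ℓ} → Pred Point ℓ → Rel Point (a ⊔ c ⊔ ℓ₁ ⊔ ℓ₂ ⊔ ℓ)
  Adjacent P x y = IsVertex P x × IsVertex P y × IsFaceOfDimension P 1 (segment x y)

  T : Pred (G⁺ → ℕ) a
  T t = (∑ᴳ (λ i → t (element⁺ i) · value (element⁺ i)) ≡ g₀) ×
        (g₀ ≡ ε → ¬ (∀ g → t g ≡ 0))

  embed : (G⁺ → ℕ) → Point
  embed t g = fromℕ (t g)

  P : Pred Point (a ⊔ c ⊔ ℓ₁ ⊔ ℓ₂)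
  P = conv (λ x → ∃[ t ] T t × (x ≈ᵖ embed t))

  data Operation : Set a where
    μ₂ : (h f : G⁺) → Operation
    μ₁ : (h : G⁺) → Operation

  leading : Operation → G⁺
  leading (μ₂ h f) = h
  leading (μ₁ h)   = h

  -- The new element as an element of G; applicability makes it nonzero.
  new : Operation → (G⁺ → ℕ) → |G|
  new (μ₂ h f) t = value h ∙ value f
  new (μ₁ h)   t = t h · value h

  Applicable : Operation → (G⁺ → ℕ) → Set a
  Applicable ν@(μ₂ h f) t =
    T t × (h ≢ f) × (0 ℕ.< t h) × (0 ℕ.< t f) × (t h ℕ.≤ t f) × (new ν t ≢ ε)
  Applicable ν@(μ₁ h) t =
    T t × (1 ℕ.< t h) × (new ν t ≢ ε)

  -- Result ν t s states s = ν(t) by its defining equations.  If t h · h = h the two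
  -- equations for μ₁ h conflict and there is no s; this cannot occur at a vertex t.
  Result : Operation → (G⁺ → ℕ) → (G⁺ → ℕ) → Set a
  Result ν@(μ₂ h f) t s =
    (s h ≡ 0) ×
    (s f ≡ t f ∸ t h) ×
    (∀ g → value g ≡ new ν t → s g ≡ t g ℕ.+ t h) ×
    (∀ g → g ≢ h → g ≢ f → value g ≢ new ν t → s g ≡ t g)
  Result ν@(μ₁ h) t s =
    (s h ≡ 0) ×
    (∀ g → value g ≡ new ν t → s g ≡ t g ℕ.+ 1) ×
    (∀ g → g ≢ h → value g ≢ new ν t → s g ≡ t g)

{-# OPTIONS --safe #-}

-- Let u be a functional whose minimum over T is attained only at the vertex t. An operation with
-- leading element h and new element k replaces a multiset v of total k by k itself, so setting
-- u k to u v turns the value at x into the value of u at the vector obtained from x by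
-- splitting every copy of k back into v. The new functional is therefore minimised exactly at the
-- vectors which split into t, and these lie on the segment from t to the next vector. Adding 1 to
-- the coefficient of h afterwards cuts t off, because h is used up. Iterating along the chain, while
-- adding 1 to the coefficients of all intermediate leading elements, yields a functional that is
-- minimised exactly on the segment from t₀ to tⱼ.
module Submission where

open import Defs
open import Level using (_⊔_)
open import Algebra.Bundles using (AbelianGroup; CommutativeMonoid; CommutativeRing)
import Algebra.Apartness.Properties.HeytingCommutativeRing as HeytingProperties
import Algebra.Properties.CommutativeMonoid.Mult as CMult
import Algebra.Properties.CommutativeMonoid.Sum as CSum
import Algebra.Properties.CommutativeSemigroup as CommutativeSemigroupLemmas
import Algebra.Properties.Group as GroupLemmas
import Algebra.Properties.Ring as RingProperties
import Algebra.Properties.Semiring.Mult as Mult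
import Algebra.Properties.Semiring.Sum as Sum
open import Data.Fin.Base using (Fin; zero; toℕ; inject₁; punchOut) renaming (suc to fsuc)
open import Data.Fin.Properties as Finₚ using (punchIn-punchOut)
open import Data.Irrelevant using ([_])
open import Data.Nat.Base as ℕ using (ℕ; zero; suc; z≤n; s≤s)
import Data.Nat.Properties as ℕₚ
open import Data.Nat.Tactic.RingSolver using (solve-∀)
open import Data.Product.Base using (∃-syntax; Σ-syntax; _×_; _,_; proj₁; proj₂)
open import Data.Refinement using (value; value-injective; _,_)
open import Data.Sum.Base using (_⊎_; inj₁; inj₂; [_,_]′)
open import Function.Base using (_∘_; const)
open import Function.Bundles using (Inverse)
open import Relation.Binary.Definitions using (DecidableEquality)
open import Relation.Binary.PropositionalEquality.Core as ≡ using (_≡_; _≢_; _≗_)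
open import Relation.Binary.PropositionalEquality.Properties using (module ≡-Reasoning)
import Relation.Binary.Reasoning.Setoid as SetoidReasoning
open import Relation.Binary.Structures using (IsStrictPartialOrder)
open import Relation.Nullary.Decidable using (yes; no; map′)
open import Relation.Nullary.Negation using (¬_; contradiction)
open import Relation.Nullary.Recomputable using (¬-recompute)
open import Relation.Unary using (_∈_)

-- The crux is that the new element k occurs in no minimiser of the current functional. Only then
-- does splitting return the next vector to t and leave the source s fixed. The argument is an
-- exchange that would produce a minimiser smaller than t. It is available because t has least size
-- among the minimisers: these lie between s and t, and operations never increase the size.
-- Freshness of k is also where the chain condition enters. When k is the leading element of the
-- next operation, a penalty on k spares s, because s contains no k. Moreover the coordinate k is
-- zero at s and positive at the far end, so it separates the two ends and serves as the parameter
-- on the segment between them. Collinearity can therefore be stated over the naturals with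
-- denominators cleared, and all combinatorics takes place on T. It passes to the convex hull
-- through affine maps only, since the order of the reals is not decidable.

-- Order and finite sums in the reals, constructively.

module RealProperties {c ℓ₁ ℓ₂} (ℝ : RealNumbers c ℓ₁ ℓ₂) where

  open RealNumbers ℝ public
    using (_≈_; _#_; _<_; _≤_; _+_; _*_; -_; _-_; 0#; 1#; fromℕ; #⇒<; <⇒#;
           +-monoˡ-<; *-pos; #-cotrans; #⇒invertible; tight)
    renaming (Carrier to R; sum to ∑; commutativeRing to ring)
  open CommutativeRing ring public
    using (setoid; refl; sym; trans; +-cong; +-congˡ; +-congʳ; *-cong; *-congˡ; *-congʳ;
           +-identityˡ; +-identityʳ; *-identityˡ; *-identityʳ; zeroˡ; zeroʳ; distribˡ; distribʳ;
           *-comm; *-assoc; +-comm; +-assoc; -‿inverseʳ; semiring; reflexive; -‿cong)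
  open HeytingProperties (RealNumbers.heytingCommutativeRing ℝ) public using (1#0; x-0≈x)
  open RingProperties (CommutativeRing.ring ring)
    using (x∙y⁻¹≈ε⇒x≈y; //-rightDividesʳ; //-rightDividesˡ; -‿distribˡ-*; -‿distribʳ-*; -‿involutive)
  open IsStrictPartialOrder (RealNumbers.<-isStrictPartialOrder ℝ)
    using (<-respˡ-≈; <-respʳ-≈) renaming (irrefl to <-irrefl; trans to <-trans; asym to <-asym)
  open Mult semiring using (×-homo-+; ×1-homo-*)
  open SetoidReasoning setoid

  private variable
    x y z w d : R

  ≤-reflexive : x ≈ y → x ≤ y
  ≤-reflexive x≈y y<x = <-irrefl (sym x≈y) y<x

  ≤-antisym : x ≤ y → y ≤ x → x ≈ y
  ≤-antisym {x} {y} x≤y y≤x = proj₁ (tight x y) ([ y≤x , x≤y ]′ ∘ #⇒<)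

  -- Given `z < x`, cotransitivity of apartness makes `y` apart from `z` or from `x`; this replaces
  -- trichotomy.
  ≤-trans : x ≤ y → y ≤ z → x ≤ z
  ≤-trans {y = y} x≤y y≤z z<x with #-cotrans (<⇒# z<x) y
  ... | inj₁ z#y = [ y≤z , (λ y<z → x≤y (<-trans y<z z<x)) ]′ (#⇒< z#y)
  ... | inj₂ y#x = [ x≤y , (λ x<y → y≤z (<-trans z<x x<y)) ]′ (#⇒< y#x)

  ≤-resp : x ≈ y → z ≈ w → x ≤ z → y ≤ w
  ≤-resp x≈y z≈w x≤z = ≤-trans (≤-reflexive (sym x≈y)) (≤-trans x≤z (≤-reflexive z≈w))

  <⇒≤ : x < y → x ≤ y
  <⇒≤ x<y y<x = <-asym x<y y<x

  private
    cancel-+ : ∀ x z → (x + z) - z ≈ x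
    cancel-+ x z = //-rightDividesʳ z x

  x-y+y≈x : ∀ x y → (x - y) + y ≈ x
  x-y+y≈x x y = //-rightDividesˡ y x

  x-y≈0⇒x≈y : ∀ x y → x - y ≈ 0# → x ≈ y
  x-y≈0⇒x≈y = x∙y⁻¹≈ε⇒x≈y

  +-monoʳ-≤ : ∀ z → x ≤ y → x + z ≤ y + z
  +-monoʳ-≤ {x} {y} z x≤y y+z<x+z =
    x≤y (<-respˡ-≈ (cancel-+ y z) (<-respʳ-≈ (cancel-+ x z) (+-monoˡ-< (- z) y+z<x+z)))

  +-mono-≤ : x ≤ y → z ≤ w → x + z ≤ y + w
  +-mono-≤ {x} {y} {z} {w} x≤y z≤w =
    ≤-trans (+-monoʳ-≤ z x≤y) (≤-resp (+-comm z y) (+-comm w y) (+-monoʳ-≤ y z≤w))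

  +-cancelʳ-≤ : ∀ z → x + z ≤ y + z → x ≤ y
  +-cancelʳ-≤ {x} {y} z x+z≤y+z = ≤-resp (cancel-+ x z) (cancel-+ y z) (+-monoʳ-≤ (- z) x+z≤y+z)

  x≤y⇒0≤y-x : x ≤ y → 0# ≤ y - x
  x≤y⇒0≤y-x {x} x≤y = ≤-resp (-‿inverseʳ x) refl (+-monoʳ-≤ (- x) x≤y)

  x<y⇒0<y-x : x < y → 0# < y - x
  x<y⇒0<y-x {x} x<y = <-respˡ-≈ (-‿inverseʳ x) (+-monoˡ-< (- x) x<y)

  -- The goal is an absurdity, so `0 < w` and `x < y` only have to be shown not to fail; if either
  -- failed, the two products would be equal.
  *-monoˡ-≤ : 0# ≤ w → x ≤ y → w * x ≤ w * y
  *-monoˡ-≤ {w} {x} {y} 0≤w x≤y wy<wx = ¬0<w λ 0<w → ¬x<y λ x<y →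
    <-asym wy<wx (<-respˡ-≈ (+-identityˡ _) (<-respʳ-≈ (lemma w x y)
      (+-monoˡ-< (w * x) (*-pos 0<w (x<y⇒0<y-x x<y)))))
    where
    lemma : ∀ w x y → w * (y - x) + w * x ≈ w * y
    lemma w x y = trans (sym (distribˡ w (y - x) x)) (*-congˡ (x-y+y≈x y x))
    ¬0<w : ¬ ¬ (0# < w)
    ¬0<w w≤0 = <-irrefl (trans (trans (*-congʳ w≈0) (zeroˡ y)) (sym (trans (*-congʳ w≈0) (zeroˡ x)))) wy<wx
      where
      w≈0 : w ≈ 0#
      w≈0 = ≤-antisym w≤0 0≤w
    ¬x<y : ¬ ¬ (x < y)
    ¬x<y y≤x = <-irrefl (*-congˡ (≤-antisym y≤x x≤y)) wy<wx

  *-nonneg : 0# ≤ x → 0# ≤ y → 0# ≤ x * y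
  *-nonneg {x} 0≤x 0≤y = ≤-resp (zeroʳ x) refl (*-monoˡ-≤ 0≤x 0≤y)

  inverse : x # 0# → ∃[ y ] y * x ≈ 1#
  inverse {x} x#0 with #⇒invertible x#0
  ... | y , yx≈1 , _ = y , trans (*-congˡ (sym (x-0≈x x))) yx≈1

  *-cancel-# : w # 0# → w * x ≈ w * y → x ≈ y
  *-cancel-# {w} {x} {y} w#0 wx≈wy with inverse w#0
  ... | v , vw≈1 = begin
    x           ≈⟨ *-identityˡ x ⟨
    1# * x      ≈⟨ *-congʳ vw≈1 ⟨
    v * w * x   ≈⟨ *-assoc v w x ⟩
    v * (w * x) ≈⟨ *-congˡ wx≈wy ⟩
    v * (w * y) ≈⟨ *-assoc v w y ⟨
    v * w * y   ≈⟨ *-congʳ vw≈1 ⟩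
    1# * y      ≈⟨ *-identityˡ y ⟩
    y           ∎

  -- Either w or d vanishes, but which of them cannot be decided; the conclusion is a negation,
  -- so it may nevertheless be proved by cases.
  weighted-≤ : 0# ≤ w → w * d ≈ 0# → (d ≈ 0# → x ≤ y) → w * x ≤ w * y
  weighted-≤ {w} {d} {x} {y} 0≤w wd≈0 x≤y wy<wx =
    <-irrefl (trans (trans (*-congʳ w≈0) (zeroˡ y)) (sym (trans (*-congʳ w≈0) (zeroˡ x)))) wy<wx
    where
    w≈0 : w ≈ 0#
    w≈0 = proj₁ (tight w 0#) λ w#0 →
      *-monoˡ-≤ 0≤w (x≤y (*-cancel-# w#0 (trans wd≈0 (sym (zeroʳ w))))) wy<wx

  0<1 : 0# < 1#
  0<1 with #⇒< 1#0
  ... | inj₂ 0<1 = 0<1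
  ... | inj₁ 1<0 = <-respʳ-≈ lemma (*-pos 0<-1 0<-1)
    where
    0<-1 : 0# < 0# - 1#
    0<-1 = x<y⇒0<y-x 1<0
    square : ∀ a → - a * - a ≈ a * a
    square a = trans (sym (-‿distribˡ-* a (- a))) (trans (-‿cong (sym (-‿distribʳ-* a a))) (-‿involutive _))
    lemma : (0# - 1#) * (0# - 1#) ≈ 1#
    lemma = trans (*-cong (+-identityˡ _) (+-identityˡ _)) (trans (square 1#) (*-identityˡ 1#))

  fromℕ-+ : ∀ m n → fromℕ (m ℕ.+ n) ≈ fromℕ m + fromℕ n
  fromℕ-+ = ×-homo-+ 1#

  fromℕ-* : ∀ m n → fromℕ (m ℕ.* n) ≈ fromℕ m * fromℕ n
  fromℕ-* = ×1-homo-*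

  0≤fromℕ : ∀ n → 0# ≤ fromℕ n
  0≤fromℕ zero    = ≤-reflexive refl
  0≤fromℕ (suc n) = ≤-resp (+-identityˡ 0#) refl (+-mono-≤ (<⇒≤ 0<1) (0≤fromℕ n))

  fromℕ-mono : ∀ {m n} → m ℕ.≤ n → fromℕ m ≤ fromℕ n
  fromℕ-mono {_} {n} z≤n   = 0≤fromℕ n
  fromℕ-mono (s≤s m≤n) = +-mono-≤ (≤-reflexive refl) (fromℕ-mono m≤n)

  fromℕ#0 : ∀ {n} → 0 ℕ.< n → fromℕ n # 0#
  fromℕ#0 {suc n} _ with #-cotrans 1#0 (fromℕ (suc n))
  ... | inj₂ n#0 = n#0
  ... | inj₁ 1#n = [ (λ 1<n → RealNumbers.#-sym ℝ (<⇒# (<-trans 0<1 1<n)))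
                   , (λ n<1 → contradiction n<1 (≤-resp (+-identityʳ 1#) refl (fromℕ-mono {1} {suc n} (s≤s z≤n)))) ]′ (#⇒< 1#n)

  fromℕ-injective : ∀ m n → fromℕ m ≈ fromℕ n → m ≡ n
  fromℕ-injective zero    zero    _   = ≡.refl
  fromℕ-injective zero    (suc n) eq = contradiction (fromℕ#0 {suc n} (s≤s z≤n)) (proj₂ (tight _ _) (sym eq))
  fromℕ-injective (suc m) zero    eq = contradiction (fromℕ#0 {suc m} (s≤s z≤n)) (proj₂ (tight _ _) eq)
  fromℕ-injective (suc m) (suc n) eq = ≡.cong suc (fromℕ-injective m n (begin
    fromℕ m             ≈⟨ cancel-+ (fromℕ m) 1# ⟨
    (fromℕ m + 1#) - 1# ≈⟨ +-congʳ (trans (+-comm _ _) (trans eq (+-comm _ _))) ⟩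
    (fromℕ n + 1#) - 1# ≈⟨ cancel-+ (fromℕ n) 1# ⟩
    fromℕ n             ∎))

  0≤x+y≈0⇒x≈0 : 0# ≤ x → 0# ≤ y → x + y ≈ 0# → x ≈ 0#
  0≤x+y≈0⇒x≈0 {x} {y} 0≤x 0≤y x+y≈0 = ≤-antisym
    (≤-resp (+-identityʳ x) x+y≈0 (+-mono-≤ (≤-reflexive refl) 0≤y)) 0≤x

  ∑-mono-≤ : ∀ {n} {a b : Fin n → R} → (∀ i → a i ≤ b i) → ∑ a ≤ ∑ b
  ∑-mono-≤ {zero}  _   = ≤-reflexive refl
  ∑-mono-≤ {suc n} a≤b = +-mono-≤ (a≤b zero) (∑-mono-≤ (a≤b ∘ fsuc))

  ∑-nonneg : ∀ {n} {a : Fin n → R} → (∀ i → 0# ≤ a i) → 0# ≤ ∑ a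
  ∑-nonneg {zero}  _   = ≤-reflexive refl
  ∑-nonneg {suc n} 0≤a = ≤-resp (+-identityˡ 0#) refl (+-mono-≤ (0≤a zero) (∑-nonneg (0≤a ∘ fsuc)))

  ∑≈0⇒≈0 : ∀ {n} {a : Fin n → R} → (∀ i → 0# ≤ a i) → ∑ a ≈ 0# → ∀ i → a i ≈ 0#
  ∑≈0⇒≈0 0≤a eq zero     = 0≤x+y≈0⇒x≈0 (0≤a zero) (∑-nonneg (0≤a ∘ fsuc)) eq
  ∑≈0⇒≈0 0≤a eq (fsuc i) = ∑≈0⇒≈0 (0≤a ∘ fsuc)
    (0≤x+y≈0⇒x≈0 (∑-nonneg (0≤a ∘ fsuc)) (0≤a zero) (trans (+-comm _ _) eq)) i

-- Multisets of nonzero group elements.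

module GroupProperties {a} (G : FiniteAbelianGroup a) where

  open FiniteAbelianGroup G using (ε; G⁺; order⁺; element⁺; enumeration) renaming (Carrier to |G|)
  open Inverse enumeration using (to; from; strictlyInverseˡ; strictlyInverseʳ)

  infix 4 _≟ᴳ_ _≟_

  _≟ᴳ_ : DecidableEquality |G|
  x ≟ᴳ y = map′ (λ eq → ≡.trans (≡.sym (strictlyInverseˡ x)) (≡.trans (≡.cong to eq) (strictlyInverseˡ y)))
                (≡.cong from) (from x Finₚ.≟ from y)

  _≟_ : DecidableEquality G⁺
  g ≟ h = map′ value-injective (≡.cong value) (value g ≟ᴳ value h)

  -- The proof stored in a refinement is irrelevant, but a negation can be recomputed from it.
  value≢ε : (g : G⁺) → value g ≢ ε
  value≢ε (_ , [ g≢ε ]) = ¬-recompute g≢ε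

  private
    from-ε≢from : (g : G⁺) → from ε ≢ from (value g)
    from-ε≢from g eq = value≢ε g (≡.trans (≡.sym (strictlyInverseˡ (value g)))
      (≡.trans (≡.cong to (≡.sym eq)) (strictlyInverseˡ ε)))

  index : G⁺ → Fin order⁺
  index g = punchOut (from-ε≢from g)

  element⁺-index : ∀ g → element⁺ (index g) ≡ g
  element⁺-index g = value-injective
    (≡.trans (≡.cong to (punchIn-punchOut (from-ε≢from g))) (strictlyInverseˡ (value g)))

  element⁺-injective : ∀ i j → element⁺ i ≡ element⁺ j → i ≡ j
  element⁺-injective i j eq = Finₚ.punchIn-injective (from ε) i j 
    (≡.trans (≡.sym (strictlyInverseʳ _)) (≡.trans (≡.cong (from ∘ value) eq) (strictlyInverseʳ _)))

  infixl 6 _⊕_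
  infixl 7 _⊗_

  Multiset : Set a
  Multiset = G⁺ → ℕ

  _⊕_ : Multiset → Multiset → Multiset
  (x ⊕ y) g = x g ℕ.+ y g

  _⊗_ : ℕ → Multiset → Multiset
  (n ⊗ x) g = n ℕ.* x g

  single : G⁺ → Multiset
  single k g with g ≟ k
  ... | yes _ = 1
  ... | no  _ = 0

  single-same : ∀ k → single k k ≡ 1
  single-same k with k ≟ k
  ... | yes _   = ≡.refl
  ... | no  k≢k = contradiction ≡.refl k≢k

  single-other : ∀ {k g} → g ≢ k → single k g ≡ 0
  single-other {k} {g} g≢k with g ≟ k
  ... | yes g≡k = contradiction g≡k g≢k
  ... | no  _   = ≡.refl

  erase : G⁺ → Multiset → Multiset
  erase k x g with g ≟ k
  ... | yes _ = 0
  ... | no  _ = x g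

  erase-other : ∀ {k g} x → g ≢ k → erase k x g ≡ x g
  erase-other {k} {g} x g≢k with g ≟ k
  ... | yes g≡k = contradiction g≡k g≢k
  ... | no  _   = ≡.refl

  erase-⊕ : ∀ k x → x ≗ erase k x ⊕ x k ⊗ single k
  erase-⊕ k x g with g ≟ k
  ... | yes ≡.refl = ≡.sym (ℕₚ.*-identityʳ (x g))
  ... | no  _      = ≡.sym (≡.trans (≡.cong (x g ℕ.+_) (ℕₚ.*-zeroʳ (x k))) (ℕₚ.+-identityʳ (x g)))

  -- The splitting map. It is not iterated: copies of `k` inside `v` itself remain.
  substitute : G⁺ → Multiset → Multiset → Multiset
  substitute k v x = erase k x ⊕ x k ⊗ v

  -- Three monoids are needed: the reals for linear functionals, the group for the sum that defines
  -- `T`, and the naturals for cardinality.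
  module Evaluation {c ℓ} (M : CommutativeMonoid c ℓ) where

    open CommutativeMonoid M renaming (ε to 0#)
    open CMult M renaming (_×_ to _·_)
    open CSum M using (sum; sum-cong-≋; ∑-distrib-+; sum-replicate-zero)
    open SetoidReasoning setoid

    eval : (G⁺ → Carrier) → Multiset → Carrier
    eval f x = sum (λ i → x (element⁺ i) · f (element⁺ i))

    eval-congˡ : ∀ {f f′} → (∀ g → f g ≈ f′ g) → ∀ x → eval f x ≈ eval f′ x
    eval-congˡ f≈f′ x = sum-cong-≋ (λ i → ×-congʳ (x (element⁺ i)) (f≈f′ (element⁺ i)))

    eval-congʳ : ∀ f {x y} → x ≗ y → eval f x ≈ eval f y
    eval-congʳ f x≗y = sum-cong-≋ (λ i → ×-congˡ (x≗y (element⁺ i)))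

    eval-⊕ : ∀ f x y → eval f (x ⊕ y) ≈ eval f x ∙ eval f y
    eval-⊕ f x y = trans (sum-cong-≋ (λ i → ×-homo-+ (f (element⁺ i)) (x (element⁺ i)) (y (element⁺ i))))
                         (∑-distrib-+ {order⁺} _ _)

    eval-0 : ∀ f → eval f (λ _ → 0) ≈ 0#
    eval-0 f = sum-replicate-zero order⁺

    eval-⊗ : ∀ f n x → eval f (n ⊗ x) ≈ n · eval f x
    eval-⊗ f zero    x = eval-0 f
    eval-⊗ f (suc n) x = trans (eval-⊕ f x (n ⊗ x)) (∙-congˡ (eval-⊗ f n x))

    eval-single : ∀ f k → eval f (single k) ≈ f k
    eval-single f k = helper (index k) (element⁺-index k)
      where
      helper : (i : Fin order⁺) → element⁺ i ≡ k → eval f (single k) ≈ f k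
      helper i eq = go order⁺ element⁺ (λ {i} {j} → element⁺-injective i j) i eq
        where
        -- Any injective enumeration is allowed, so that the induction can drop its first element.
        go : ∀ n (e : Fin n → G⁺) → (∀ {i j} → e i ≡ e j → i ≡ j) → ∀ i → e i ≡ k →
             sum (λ i → single k (e i) · f (e i)) ≈ f k
        go (suc n) e inj zero ≡.refl = begin
          single k k · f k ∙ sum (λ i → single k (e (fsuc i)) · f (e (fsuc i)))
            ≈⟨ ∙-cong (×-congˡ (single-same k)) (sum-cong-≋ {n} λ i → ×-congˡ (single-other λ p → Finₚ.0≢1+n (≡.sym (inj p)))) ⟩
          1 · f k ∙ sum {n} (λ i → 0#)
            ≈⟨ ∙-cong (×-homo-1 (f k)) (sum-replicate-zero n) ⟩
          f k ∙ 0#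
            ≈⟨ identityʳ (f k) ⟩
          f k ∎
        go (suc n) e inj (fsuc i) eq = begin
          single k (e zero) · f (e zero) ∙ sum (λ i → single k (e (fsuc i)) · f (e (fsuc i)))
            ≈⟨ ∙-cong (×-congˡ (single-other λ p → Finₚ.0≢1+n (inj (≡.trans p (≡.sym eq)))))
                      (go n (e ∘ fsuc) (Finₚ.suc-injective ∘ inj) i eq) ⟩
          0# ∙ f k
            ≈⟨ identityˡ (f k) ⟩
          f k ∎

    _[_≔_] : (G⁺ → Carrier) → G⁺ → Carrier → G⁺ → Carrier
    (f [ k ≔ m ]) g with g ≟ k
    ... | yes _ = m
    ... | no  _ = f g

    ≔-same : ∀ f k m → (f [ k ≔ m ]) k ≈ m
    ≔-same f k m with k ≟ k
    ... | yes _   = refl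
    ... | no  k≢k = contradiction ≡.refl k≢k

    ≔-trivial : ∀ f k {m} → m ≈ f k → ∀ g → (f [ k ≔ m ]) g ≈ f g
    ≔-trivial f k eq g with g ≟ k
    ... | yes ≡.refl = eq
    ... | no  _      = refl

    eval-erase : ∀ f k m x → eval (f [ k ≔ m ]) (erase k x) ≈ eval f (erase k x)
    eval-erase f k m x = sum-cong-≋ (pointwise ∘ element⁺)
      where
      pointwise : ∀ g → erase k x g · (f [ k ≔ m ]) g ≈ erase k x g · f g
      pointwise g with g ≟ k
      ... | yes _ = refl
      ... | no  _ = refl

    eval-≔ : ∀ f k m x → eval (f [ k ≔ m ]) x ≈ eval f (erase k x) ∙ x k · m
    eval-≔ f k m x = begin
      eval f′ x                                        ≈⟨ eval-congʳ f′ (erase-⊕ k x) ⟩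
      eval f′ (erase k x ⊕ x k ⊗ single k)             ≈⟨ eval-⊕ f′ (erase k x) (x k ⊗ single k) ⟩
      eval f′ (erase k x) ∙ eval f′ (x k ⊗ single k)   ≈⟨ ∙-cong (eval-erase f k m x) (eval-⊗ f′ (x k) (single k)) ⟩
      eval f (erase k x) ∙ x k · eval f′ (single k)    ≈⟨ ∙-congˡ (×-congʳ (x k) (trans (eval-single f′ k) (≔-same f k m))) ⟩
      eval f (erase k x) ∙ x k · m                     ∎
      where f′ = f [ k ≔ m ]

    -- Splitting the argument and repricing `k` both charge `eval f v` for each copy of `k`. Over
    -- the reals this makes the tied inequality valid; in the group it shows that splitting
    -- preserves the total.
    eval-substitute : ∀ f k v x → eval f (substitute k v x) ≈ eval (f [ k ≔ eval f v ]) x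
    eval-substitute f k v x = begin
      eval f (substitute k v x)                ≈⟨ eval-⊕ f (erase k x) (x k ⊗ v) ⟩
      eval f (erase k x) ∙ eval f (x k ⊗ v)    ≈⟨ ∙-congˡ (eval-⊗ f (x k) v) ⟩
      eval f (erase k x) ∙ x k · eval f v      ≈⟨ eval-≔ f k (eval f v) x ⟨
      eval (f [ k ≔ eval f v ]) x              ∎

    eval-split : ∀ f k x → eval f x ≈ eval f (erase k x) ∙ x k · f k
    eval-split f k x = trans (eval-congˡ (λ g → sym (≔-trivial f k refl g)) x) (eval-≔ f k (f k) x)

-- Valid inequalities on `T` and their tight points.

module CornerProperties {c ℓ₁ ℓ₂ a} (ℝ : RealNumbers c ℓ₁ ℓ₂) (G : FiniteAbelianGroup a)
                        (g₀ : FiniteAbelianGroup.Carrier G) where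

  open RealProperties ℝ
  open GroupProperties G
  open MasterCorner ℝ G g₀
  open AbelianGroup (FiniteAbelianGroup.abelianGroup G) using (group; commutativeMonoid)
  open GroupLemmas group using (∙-cancelʳ)
  open GroupLemmas (CommutativeRing.+-group ring) using () renaming (∙-cancelˡ to +-cancelˡ)
  open CMult (CommutativeRing.+-commutativeMonoid ring) using (×-distrib-+)

  open CMult ℕₚ.+-0-commutativeMonoid using () renaming (_×_ to _×ℕ_)

  module Real  = Evaluation (CommutativeRing.+-commutativeMonoid ring)
  module Group = Evaluation commutativeMonoid
  module Nat   = Evaluation ℕₚ.+-0-commutativeMonoid

  total : Multiset → |G|
  total = Group.eval value

  size : Multiset → ℕ
  size = Nat.eval (λ _ → 1)

  ×≡* : ∀ m n → m ×ℕ n ≡ m ℕ.* n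
  ×≡* zero    n = ≡.refl
  ×≡* (suc m) n = ≡.cong (n ℕ.+_) (×≡* m n)

  size-⊗ : ∀ n x → size (n ⊗ x) ≡ n ℕ.* size x
  size-⊗ n x = ≡.trans (Nat.eval-⊗ (λ _ → 1) n x) (×≡* n (size x))

  size-cong : ∀ {x y} → x ≗ y → size x ≡ size y
  size-cong = Nat.eval-congʳ (λ _ → 1)

  size-⊕ : ∀ x y → size (x ⊕ y) ≡ size x ℕ.+ size y
  size-⊕ = Nat.eval-⊕ (λ _ → 1)

  size-single : ∀ k → size (single k) ≡ 1
  size-single = Nat.eval-single (λ _ → 1)

  size-comb : ∀ m x n y → size (m ⊗ x ⊕ n ⊗ y) ≡ m ℕ.* size x ℕ.+ n ℕ.* size y
  size-comb m x n y = ≡.trans (size-⊕ (m ⊗ x) (n ⊗ y)) (≡.cong₂ ℕ._+_ (size-⊗ m x) (size-⊗ n y))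

  -- Positivity of `v h` protects the exclusion of the zero vector: every copy of `k` that is split
  -- leaves some `h` behind.
  T-substitute : ∀ {k v h x} → total v ≡ value k → 0 ℕ.< v h → T x → T (substitute k v x)
  T-substitute {k} {v} {h} {x} total-v 0<vh (eq , nz) =
    ≡.trans (Group.eval-substitute value k v x)
      (≡.trans (Group.eval-congˡ (Group.≔-trivial value k total-v) x) eq) ,
    λ g₀≡ε zero′ → nz g₀≡ε (nonzero zero′)
    where
    nonzero : (∀ g → substitute k v x g ≡ 0) → ∀ g → x g ≡ 0
    nonzero zero′ g with g ≟ k
    ... | no g≢k = ≡.trans (≡.sym (erase-other x g≢k)) (ℕₚ.m+n≡0⇒m≡0 (erase k x g) (zero′ g))
    ... | yes ≡.refl with ℕₚ.m*n≡0⇒m≡0∨n≡0 (x g) (ℕₚ.m+n≡0⇒n≡0 (erase k x h) (zero′ h))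
    ...   | inj₁ xg≡0 = xg≡0
    ...   | inj₂ vh≡0 = contradiction (≡.sym vh≡0) (ℕₚ.<⇒≢ 0<vh)

  record Inequality : Set (a ⊔ c ⊔ ℓ₁ ⊔ ℓ₂) where
    field
      coeff : Point
      bound : R
      valid : ∀ x → T x → bound ≤ Real.eval coeff x

  open Inequality

  Tight : Inequality → Multiset → Set ℓ₁
  Tight F x = Real.eval (coeff F) x ≈ bound F

  Tight-cong : ∀ F {x y} → x ≗ y → Tight F x → Tight F y
  Tight-cong F x≗y tx = trans (sym (Real.eval-congʳ (coeff F) x≗y)) tx

  module Raise (F : Inequality) (k : G⁺) where
    u′ : Point
    u′ = coeff F Real.[ k ≔ coeff F k + 1# ]

    eval-raise : ∀ x → Real.eval u′ x ≈ Real.eval (coeff F) x + fromℕ (x k)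
    eval-raise x = trans (Real.eval-≔ (coeff F) k _ x) (trans (+-congˡ (×-distrib-+ (coeff F k) 1# (x k)))
      (trans (sym (+-assoc _ _ _)) (+-congʳ (sym (Real.eval-split (coeff F) k x)))))

    raise : Inequality
    raise .coeff = u′
    raise .bound = bound F
    raise .valid x Tx = ≤-resp (+-identityʳ _) (sym (eval-raise x)) (+-mono-≤ (valid F x Tx) (0≤fromℕ (x k)))

    tight-raise⁺ : ∀ x → Tight F x → x k ≡ 0 → Tight raise x
    tight-raise⁺ x tx xk≡0 = trans (eval-raise x)
      (trans (+-cong tx (reflexive (≡.cong fromℕ xk≡0))) (+-identityʳ _))

    -- The slack for `F` and the penalty `x k` are both nonnegative, so their sum vanishes only if
    -- both do.
    tight-raise⁻ : ∀ {x} → T x → Tight raise x → Tight F x × x k ≡ 0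
    tight-raise⁻ {x} Tx tx = tF , fromℕ-injective (x k) 0 (+-cancelˡ (bound F) _ _
        (trans (+-congʳ (sym tF)) (trans eq (sym (+-identityʳ _)))))
      where
      eq : Real.eval (coeff F) x + fromℕ (x k) ≈ bound F
      eq = trans (sym (eval-raise x)) tx
      tF : Tight F x
      tF = ≤-antisym (≤-resp (+-identityʳ _) eq (+-mono-≤ (≤-reflexive refl) (0≤fromℕ (x k)))) (valid F x Tx)

  module Tie (F : Inequality) {k : G⁺} {v : Multiset} {h : G⁺}
             (total-v : total v ≡ value k) (0<vh : 0 ℕ.< v h) where
    tie : Inequality
    tie .coeff = coeff F Real.[ k ≔ Real.eval (coeff F) v ]
    tie .bound = bound F
    tie .valid x Tx = ≤-resp refl (Real.eval-substitute (coeff F) k v x)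
      (valid F (substitute k v x) (T-substitute total-v 0<vh Tx))

    tight-tie⁺ : ∀ x → Tight F (substitute k v x) → Tight tie x
    tight-tie⁺ x = trans (sym (Real.eval-substitute (coeff F) k v x))

    tight-tie⁻ : ∀ x → Tight tie x → Tight F (substitute k v x)
    tight-tie⁻ x = trans (Real.eval-substitute (coeff F) k v x)

  -- The values at `x` and `y` add up to twice the bound, and neither is below it.
  tight-summand : ∀ F {x y t p} → T x → T y → Tight F t → Tight F p → x ⊕ y ≗ t ⊕ p → Tight F x
  tight-summand F {x} {y} {t} {p} Tx Ty tt tp eq = ≤-antisym
    (+-cancelʳ-≤ (bound F) (≤-resp refl sum≈ (+-mono-≤ (≤-reflexive refl) (valid F y Ty)))) (valid F x Tx)
    where
    e = Real.eval (coeff F)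
    sum≈ : e x + e y ≈ bound F + bound F
    sum≈ = trans (sym (Real.eval-⊕ (coeff F) x y)) (trans (Real.eval-congʳ (coeff F) eq)
      (trans (Real.eval-⊕ (coeff F) t p) (+-cong tt tp)))

  -- A common form of both kinds of operation with leading element h and new element k: a number
  -- of copies of one multiset, which together use up h, are merged into as many copies of k.
  record Exchange (h : G⁺) (t : Multiset) (k : G⁺) (t′ : Multiset) : Set a where
    field
      merged   : Multiset
      times    : ℕ
      total-v  : total merged ≡ value k
      size-v   : 2 ℕ.≤ size merged
      0<times  : 0 ℕ.< times
      0<th     : 0 ℕ.< t h
      uses-h   : times ℕ.* merged h ≡ t h
      fits     : ∀ g → times ℕ.* merged g ℕ.≤ t g
      result   : t′ ⊕ times ⊗ merged ≗ t ⊕ times ⊗ single k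

  -- For positive `t h`, `collinear` is x = s + (x h / t h)(t - s) freed of division and
  -- subtraction, and `below` keeps the parameter at most 1. The case `s = t` is included so that a
  -- chain can start at a vertex.
  record Span (s t : Multiset) (h : G⁺) : Set (a ⊔ c ⊔ ℓ₁ ⊔ ℓ₂) where
    field
      face      : Inequality
      T-s       : T s
      T-t       : T t
      tight-s   : Tight face s
      tight-t   : Tight face t
      shrinks   : size t ℕ.≤ size s
      below     : ∀ x → T x → Tight face x → x h ℕ.≤ t h
      collinear : ∀ x → T x → Tight face x → t h ⊗ x ⊕ x h ⊗ s ≗ t h ⊗ s ⊕ x h ⊗ t

  -- The equation makes `x` the mean of `s` and `t` with weights (a - b)/a and b/a, hence no less
  -- than the smaller of them.
  convexity-≤ : ∀ {a b x s t} → 0 ℕ.< a → b ℕ.≤ a → t ℕ.≤ s →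
                a ℕ.* x ℕ.+ b ℕ.* s ≡ a ℕ.* s ℕ.+ b ℕ.* t → t ℕ.≤ x
  convexity-≤ {a@(suc _)} {b} {x} {s} {t} _ b≤a t≤s eq = ℕₚ.*-cancelˡ-≤ a (begin
    a ℕ.* t                 ≡⟨ ≡.cong (ℕ._* t) (≡.sym (ℕₚ.m∸n+n≡m b≤a)) ⟩
    (e ℕ.+ b) ℕ.* t         ≡⟨ ℕₚ.*-distribʳ-+ t e b ⟩
    e ℕ.* t ℕ.+ b ℕ.* t     ≤⟨ ℕₚ.+-monoˡ-≤ (b ℕ.* t) (ℕₚ.*-monoʳ-≤ e t≤s) ⟩
    e ℕ.* s ℕ.+ b ℕ.* t     ≡⟨ ℕₚ.+-cancelʳ-≡ (b ℕ.* s) _ _ (≡.trans (rearrange e b s t)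
                                (≡.trans (≡.cong (λ n → n ℕ.* s ℕ.+ b ℕ.* t) (ℕₚ.m∸n+n≡m b≤a)) (≡.sym eq))) ⟩
    a ℕ.* x                 ∎)
    where
    open ℕₚ.≤-Reasoning
    e = a ℕ.∸ b
    rearrange : ∀ e b s t → e ℕ.* s ℕ.+ b ℕ.* t ℕ.+ b ℕ.* s ≡ (e ℕ.+ b) ℕ.* s ℕ.+ b ℕ.* t
    rearrange = solve-∀

  -- Size is linear along the segment and `t` is its smaller end. This is the minimality that the
  -- exchange argument for freshness requires.
  minimal : ∀ {s t h} (S : Span s t h) → 0 ℕ.< t h →
            ∀ x → T x → Tight (Span.face S) x → size t ℕ.≤ size x
  minimal {s} {t} {h} S 0<th x Tx tx = convexity-≤ 0<th (below x Tx tx) shrinks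
    (≡.trans (≡.sym (size-comb (t h) x (x h) s))
      (≡.trans (size-cong (collinear x Tx tx)) (size-comb (t h) s (x h) t)))
    where open Span S

  module _ {h t k t′} (X : Exchange h t k t′) where
    open Exchange X renaming (merged to v; times to b)

    v≤t : ∀ g → v g ℕ.≤ t g
    v≤t g = ℕₚ.≤-trans (ℕₚ.m≤n*m (v g) b {{ℕ.>-nonZero 0<times}}) (fits g)

    0<vh : 0 ℕ.< v h
    0<vh = ℕₚ.n≢0⇒n>0 λ vh≡0 → ℕₚ.<⇒≢ 0<th
      (≡.trans (≡.sym (ℕₚ.*-zeroʳ b)) (≡.trans (≡.cong (b ℕ.*_) (≡.sym vh≡0)) uses-h))

    -- Otherwise t - v + k and p + v - k would be two points of T on the face, with the same sum as
    -- t and p, and the first of them would be smaller than t.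
    new-fresh : ∀ F → T t → Tight F t → (∀ x → T x → Tight F x → size t ℕ.≤ size x) →
                ∀ p → T p → Tight F p → p k ≡ 0
    new-fresh F Tt tt min p Tp tp = ℕₚ.n≤0⇒n≡0 (ℕₚ.≮⇒≥ absurd)
      where
      absurd : ¬ (0 ℕ.< p k)
      absurd 0<pk = ℕₚ.<-irrefl ≡.refl (begin-strict
        size t ℕ.+ 1       <⟨ ℕₚ.+-monoʳ-< (size t) size-v ⟩
        size t ℕ.+ size v  ≤⟨ ℕₚ.+-monoˡ-≤ (size v) (min y Ty (tight-summand F {y} {z} {t} {p} Ty Tz tt tp y⊕z)) ⟩
        size y ℕ.+ size v  ≡⟨ size-⊕ y v ⟨
        size (y ⊕ v)       ≡⟨ size-cong y⊕v ⟩
        size (t ⊕ single k) ≡⟨ size-⊕ t (single k) ⟩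
        size t ℕ.+ size (single k) ≡⟨ ≡.cong (size t ℕ.+_) (size-single k) ⟩
        size t ℕ.+ 1       ∎)
        where
        open ℕₚ.≤-Reasoning
        y z : Multiset
        y g = t g ℕ.+ single k g ℕ.∸ v g
        z g = p g ℕ.+ v g ℕ.∸ single k g
        single≤p : ∀ g → single k g ℕ.≤ p g
        single≤p g with g ≟ k
        ... | yes ≡.refl = 0<pk
        ... | no  _      = z≤n
        y⊕v : y ⊕ v ≗ t ⊕ single k
        y⊕v g = ℕₚ.m∸n+n≡m (ℕₚ.≤-trans (v≤t g) (ℕₚ.m≤m+n (t g) _))
        z⊕k : z ⊕ single k ≗ p ⊕ v
        z⊕k g = ℕₚ.m∸n+n≡m (ℕₚ.≤-trans (single≤p g) (ℕₚ.m≤m+n (p g) _))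
        y⊕z : y ⊕ z ≗ t ⊕ p
        y⊕z g = ℕₚ.+-cancelʳ-≡ (v g ℕ.+ single k g) _ _ (≡.trans (swap (y g) (z g) (v g) (single k g))
          (≡.trans (≡.cong₂ ℕ._+_ (y⊕v g) (z⊕k g)) (swap′ (t g) (p g) (v g) (single k g))))
          where
          swap : ∀ y z v e → (y ℕ.+ z) ℕ.+ (v ℕ.+ e) ≡ (y ℕ.+ v) ℕ.+ (z ℕ.+ e)
          swap = solve-∀
          swap′ : ∀ t p v e → (t ℕ.+ e) ℕ.+ (p ℕ.+ v) ≡ (t ℕ.+ p) ℕ.+ (v ℕ.+ e)
          swap′ = solve-∀
        total-cancel : ∀ x w r q → total w ≡ total q → x ⊕ w ≗ r ⊕ q → total x ≡ total r
        total-cancel x w r q w≡q eq = ∙-cancelʳ (total q) _ _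
          (≡.trans (≡.cong (total x ∙_) (≡.sym w≡q)) (≡.trans (≡.sym (Group.eval-⊕ value x w))
            (≡.trans (Group.eval-congʳ value eq) (Group.eval-⊕ value r q))))
        v≡k : total v ≡ total (single k)
        v≡k = ≡.trans total-v (≡.sym (Group.eval-single value k))
        Ty : T y
        -- If `y` vanished, `y ⊕ v` would contain at most `t k` copies of `k`, too few for
        -- `t ⊕ single k`.
        Ty = ≡.trans (total-cancel y v t (single k) v≡k y⊕v) (proj₁ Tt) , λ _ y≡0 → ℕₚ.<-irrefl ≡.refl
          (begin-strict
            t k                 <⟨ ℕₚ.n<1+n (t k) ⟩
            suc (t k)           ≡⟨ ℕₚ.+-comm 1 (t k) ⟩
            t k ℕ.+ 1           ≡⟨ ≡.cong (t k ℕ.+_) (single-same k) ⟨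
            t k ℕ.+ single k k  ≡⟨ y⊕v k ⟨
            y k ℕ.+ v k         ≡⟨ ≡.cong (ℕ._+ v k) (y≡0 k) ⟩
            v k                 ≤⟨ v≤t k ⟩
            t k                 ∎)
        Tz : T z
        -- If `z` vanished, `p ⊕ v` would be the single element `k`, whereas `v` alone has size at
        -- least 2.
        Tz = ≡.trans (total-cancel z (single k) p v (≡.sym v≡k) z⊕k) (proj₁ Tp) , λ _ z≡0 → ℕₚ.<-irrefl ≡.refl
          (begin-strict
            1                          <⟨ size-v ⟩
            size v                     ≤⟨ ℕₚ.m≤n+m (size v) (size p) ⟩
            size p ℕ.+ size v          ≡⟨ size-⊕ p v ⟨
            size (p ⊕ v)               ≡⟨ size-cong z⊕k ⟨
            size (z ⊕ single k)        ≡⟨ size-cong (λ g → ≡.cong (ℕ._+ single k g) (z≡0 g)) ⟩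
            size (single k)            ≡⟨ size-single k ⟩
            1                          ∎)

    merge-size : size t′ ℕ.≤ size t
    merge-size = ℕₚ.+-cancelʳ-≤ (b ℕ.* size v) _ _ (begin
      size t′ ℕ.+ b ℕ.* size v   ≡⟨ ≡.cong (size t′ ℕ.+_) (size-⊗ b v) ⟨
      size t′ ℕ.+ size (b ⊗ v)   ≡⟨ size-⊕ t′ (b ⊗ v) ⟨
      size (t′ ⊕ b ⊗ v)          ≡⟨ size-cong result ⟩
      size (t ⊕ b ⊗ single k)    ≡⟨ size-⊕ t (b ⊗ single k) ⟩
      size t ℕ.+ size (b ⊗ single k) ≡⟨ ≡.cong (size t ℕ.+_) (size-⊗ b (single k)) ⟩
      size t ℕ.+ b ℕ.* size (single k) ≡⟨ ≡.cong (λ n → size t ℕ.+ b ℕ.* n) (size-single k) ⟩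
      size t ℕ.+ b ℕ.* 1         ≤⟨ ℕₚ.+-monoʳ-≤ (size t) (ℕₚ.*-monoʳ-≤ b (ℕₚ.<⇒≤ size-v)) ⟩
      size t ℕ.+ b ℕ.* size v    ∎)
      where open ℕₚ.≤-Reasoning

    merge-total : total t′ ≡ total t
    merge-total = ∙-cancelʳ (total (b ⊗ v)) _ _ (begin
      total t′ ∙ total (b ⊗ v)        ≡⟨ Group.eval-⊕ value t′ (b ⊗ v) ⟨
      total (t′ ⊕ b ⊗ v)              ≡⟨ Group.eval-congʳ value result ⟩
      total (t ⊕ b ⊗ single k)        ≡⟨ Group.eval-⊕ value t (b ⊗ single k) ⟩
      total t ∙ total (b ⊗ single k)  ≡⟨ ≡.cong (total t ∙_) (Group.eval-⊗ value b (single k)) ⟩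
      total t ∙ (b · total (single k)) ≡⟨ ≡.cong (λ x → total t ∙ (b · x)) (≡.trans (Group.eval-single value k) (≡.sym total-v)) ⟩
      total t ∙ (b · total v)         ≡⟨ ≡.cong (total t ∙_) (Group.eval-⊗ value b v) ⟨
      total t ∙ total (b ⊗ v)         ∎)
      where open ≡-Reasoning

    -- When `t` contains no `k`, the copies of `k` in `t′` are exactly the `b` merged ones, so
    -- splitting undoes the operation.
    module Fresh (tk≡0 : t k ≡ 0) where

      h≢k : h ≢ k
      h≢k ≡.refl = ℕₚ.<⇒≢ 0<th (≡.sym tk≡0)

      bvk≡0 : b ℕ.* v k ≡ 0
      bvk≡0 = ℕₚ.n≤0⇒n≡0 (≡.subst (b ℕ.* v k ℕ.≤_) tk≡0 (fits k))

      t′k≡b : t′ k ≡ b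
      t′k≡b = begin
        t′ k                      ≡⟨ ℕₚ.+-identityʳ (t′ k) ⟨
        t′ k ℕ.+ 0                ≡⟨ ≡.cong (t′ k ℕ.+_) bvk≡0 ⟨
        t′ k ℕ.+ b ℕ.* v k        ≡⟨ result k ⟩
        t k ℕ.+ b ℕ.* single k k  ≡⟨ ≡.cong₂ (λ m n → m ℕ.+ b ℕ.* n) tk≡0 (single-same k) ⟩
        b ℕ.* 1                   ≡⟨ ℕₚ.*-identityʳ b ⟩
        b                         ∎
        where open ≡-Reasoning

      t′-other : ∀ {g} → g ≢ k → t′ g ℕ.+ b ℕ.* v g ≡ t g
      t′-other {g} g≢k = begin
        t′ g ℕ.+ b ℕ.* v g        ≡⟨ result g ⟩
        t g ℕ.+ b ℕ.* single k g  ≡⟨ ≡.cong (λ n → t g ℕ.+ b ℕ.* n) (single-other g≢k) ⟩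
        t g ℕ.+ b ℕ.* 0           ≡⟨ ≡.cong (t g ℕ.+_) (ℕₚ.*-zeroʳ b) ⟩
        t g ℕ.+ 0                 ≡⟨ ℕₚ.+-identityʳ (t g) ⟩
        t g                       ∎
        where open ≡-Reasoning

      0<t′k : 0 ℕ.< t′ k
      0<t′k = ≡.subst (0 ℕ.<_) (≡.sym t′k≡b) 0<times

      t′h≡0 : t′ h ≡ 0
      t′h≡0 = ℕₚ.+-cancelʳ-≡ (b ℕ.* v h) _ _ (≡.trans (t′-other h≢k) (≡.sym uses-h))

      T-t′ : T t → T t′
      T-t′ (eq , _) = ≡.trans merge-total eq , λ _ t′≡0 → ℕₚ.<⇒≢ 0<t′k (≡.sym (t′≡0 k))

      substitute-t′ : substitute k v t′ ≗ t
      substitute-t′ g with g ≟ k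
      ... | yes ≡.refl = ≡.trans (≡.cong (ℕ._* v k) t′k≡b) (≡.trans bvk≡0 (≡.sym tk≡0))
      ... | no  g≢k    = ≡.trans (≡.cong (λ n → t′ g ℕ.+ n ℕ.* v g) t′k≡b) (t′-other g≢k)

      substitute-fresh : ∀ {s} → s k ≡ 0 → substitute k v s ≗ s
      substitute-fresh {s} sk≡0 g with g ≟ k
      ... | yes ≡.refl = ≡.trans (≡.cong (ℕ._* v k) sk≡0) (≡.sym sk≡0)
      ... | no  g≢k    = ≡.trans (≡.cong (λ n → s g ℕ.+ n ℕ.* v g) sk≡0) (ℕₚ.+-identityʳ (s g))

      substitute-h : ∀ x → substitute k v x h ≡ x h ℕ.+ x k ℕ.* v h
      substitute-h x = ≡.cong (ℕ._+ x k ℕ.* v h) (erase-other x h≢k)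

  -- One coordinate of collinearity at the split point: `q` is `v h`, `b * q` is `t h`, and
  -- `xh + l * q` is the amount of `h` after splitting. The terms with `xh` and with `l * v` cancel,
  -- and the rest is divisible by `q`.
  cancel-collinear : ∀ {b q x xh l v s t t′} → 0 ℕ.< q → t′ ℕ.+ b ℕ.* v ≡ t → xh ℕ.* s ≡ xh ℕ.* t →
    b ℕ.* q ℕ.* (x ℕ.+ l ℕ.* v) ℕ.+ (xh ℕ.+ l ℕ.* q) ℕ.* s ≡ b ℕ.* q ℕ.* s ℕ.+ (xh ℕ.+ l ℕ.* q) ℕ.* t →
    b ℕ.* x ℕ.+ l ℕ.* s ≡ b ℕ.* s ℕ.+ l ℕ.* t′
  cancel-collinear {b} {q} {x} {xh} {l} {v} {s} {t} {t′} 0<q ≡.refl xhs≡xht eq =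
    ℕₚ.*-cancelˡ-≡ _ _ q {{ℕ.>-nonZero 0<q}}
      (ℕₚ.+-cancelʳ-≡ (b ℕ.* q ℕ.* (l ℕ.* v) ℕ.+ xh ℕ.* s) _ _ (begin
        q ℕ.* (b ℕ.* x ℕ.+ l ℕ.* s) ℕ.+ (b ℕ.* q ℕ.* (l ℕ.* v) ℕ.+ xh ℕ.* s)
          ≡⟨ left b q x xh l v s ⟩
        b ℕ.* q ℕ.* (x ℕ.+ l ℕ.* v) ℕ.+ (xh ℕ.+ l ℕ.* q) ℕ.* s
          ≡⟨ eq ⟩
        b ℕ.* q ℕ.* s ℕ.+ (xh ℕ.+ l ℕ.* q) ℕ.* t
          ≡⟨ right b q xh l v s t′ ⟩
        q ℕ.* (b ℕ.* s ℕ.+ l ℕ.* t′) ℕ.+ (b ℕ.* q ℕ.* (l ℕ.* v) ℕ.+ xh ℕ.* t)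
          ≡⟨ ≡.cong (λ n → q ℕ.* (b ℕ.* s ℕ.+ l ℕ.* t′) ℕ.+ (b ℕ.* q ℕ.* (l ℕ.* v) ℕ.+ n)) xhs≡xht ⟨
        q ℕ.* (b ℕ.* s ℕ.+ l ℕ.* t′) ℕ.+ (b ℕ.* q ℕ.* (l ℕ.* v) ℕ.+ xh ℕ.* s) ∎))
    where
    open ≡-Reasoning
    left : ∀ b q x xh l v s → q ℕ.* (b ℕ.* x ℕ.+ l ℕ.* s) ℕ.+ (b ℕ.* q ℕ.* (l ℕ.* v) ℕ.+ xh ℕ.* s) ≡
           b ℕ.* q ℕ.* (x ℕ.+ l ℕ.* v) ℕ.+ (xh ℕ.+ l ℕ.* q) ℕ.* s
    left = solve-∀
    right : ∀ b q xh l v s t′ → b ℕ.* q ℕ.* s ℕ.+ (xh ℕ.+ l ℕ.* q) ℕ.* (t′ ℕ.+ b ℕ.* v) ≡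
            q ℕ.* (b ℕ.* s ℕ.+ l ℕ.* t′) ℕ.+ (b ℕ.* q ℕ.* (l ℕ.* v) ℕ.+ xh ℕ.* (t′ ℕ.+ b ℕ.* v))
    right = solve-∀

  -- The two extra conditions separate the ends by the coordinate `h` and allow the next step to
  -- penalise `h` while keeping `s` tight.
  record Edge (s t : Multiset) (h : G⁺) : Set (a ⊔ c ⊔ ℓ₁ ⊔ ℓ₂) where
    field
      span  : Span s t h
      sh≡0  : s h ≡ 0
      0<th  : 0 ℕ.< t h

  record Vertex (t : Multiset) : Set (a ⊔ c ⊔ ℓ₁ ⊔ ℓ₂) where
    field
      face    : Inequality
      T-t     : T t
      tight-t : Tight face t
      unique  : ∀ x → T x → Tight face x → x ≗ t

  Vertex⇒Span : ∀ {t} → Vertex t → ∀ h → Span t t h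
  Vertex⇒Span {t} V h = record
    { face      = face
    ; T-s       = T-t
    ; T-t       = T-t
    ; tight-s   = tight-t
    ; tight-t   = tight-t
    ; shrinks   = ℕₚ.≤-refl
    ; below     = λ x Tx tx → ℕₚ.≤-reflexive (unique x Tx tx h)
    ; collinear = λ x Tx tx g → ≡.cong (λ n → t h ℕ.* n ℕ.+ x h ℕ.* t g) (unique x Tx tx g)
    }
    where open Vertex V

  -- The face is lifted so that k costs as much as v; if s ≠ t, points which still use h are then
  -- penalised, which removes t but neither s nor t′.
  Span⇒Edge : ∀ {s t h k t′} → Span s t h → s ≗ t ⊎ s h ≡ 0 → Exchange h t k t′ → Edge s t′ k
  Span⇒Edge {s} {t} {h} {k} {t′} S cases X = record
    { span = record
      { face      = lifted .proj₁
      ; T-s       = T-s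
      ; T-t       = T-t′ T-t
      ; tight-s   = lifted .proj₂ .proj₁
      ; tight-t   = lifted .proj₂ .proj₂ .proj₁
      ; shrinks   = ℕₚ.≤-trans (merge-size X) shrinks
      ; below     = λ x Tx tx → let tie , _ = lifted .proj₂ .proj₂ .proj₂ x Tx tx in
                      ≡.subst (x k ℕ.≤_) (≡.sym t′k≡b) (below′ x Tx tie)
      ; collinear = λ x Tx tx → let tie , eq = lifted .proj₂ .proj₂ .proj₂ x Tx tx in
                      collinear′ x Tx tie eq
      }
    ; sh≡0 = sk≡0
    ; 0<th = 0<t′k
    }
    where
    open Span S
    open Exchange X renaming (merged to v; times to b)
    fresh : ∀ p → T p → Tight face p → p k ≡ 0
    fresh = new-fresh X face T-t tight-t (minimal S 0<th)
    sk≡0 : s k ≡ 0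
    sk≡0 = fresh s T-s tight-s
    open Fresh X (fresh t T-t tight-t)
    open Tie face {k} {v} {h} total-v (0<vh X)

    tie-s : Tight tie s
    tie-s = tight-tie⁺ s (Tight-cong face (λ g → ≡.sym (substitute-fresh {s} sk≡0 g)) tight-s)

    tie-t′ : Tight tie t′
    tie-t′ = tight-tie⁺ t′ (Tight-cong face (λ g → ≡.sym (substitute-t′ g)) tight-t)

    lift : s ≗ t ⊎ s h ≡ 0 → Σ[ F ∈ Inequality ] Tight F s × Tight F t′ ×
           (∀ x → T x → Tight F x → Tight tie x × ∀ g → x h ℕ.* s g ≡ x h ℕ.* t g)
    -- A penalty on `h` would here remove `s` as well; the tied face already is the segment from `t`
    -- to `t′`.
    lift (inj₁ s≗t)  = tie , tie-s , tie-t′ , λ x _ tx → tx , λ g → ≡.cong (x h ℕ.*_) (s≗t g)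
    lift (inj₂ sh≡0) = raise , tight-raise⁺ s tie-s sh≡0 , tight-raise⁺ t′ tie-t′ t′h≡0 , λ x Tx tx →
      let tx′ , xh≡0 = tight-raise⁻ Tx tx in
      tx′ , λ g → ≡.trans (≡.cong (ℕ._* s g) xh≡0) (≡.sym (≡.cong (ℕ._* t g) xh≡0))
      where open Raise tie h
    lifted = lift cases

    below′ : ∀ x → T x → Tight tie x → x k ℕ.≤ b
    below′ x Tx tx = ℕₚ.*-cancelʳ-≤ (x k) b (v h) {{ℕ.>-nonZero (0<vh X)}} (begin
      x k ℕ.* v h           ≤⟨ ℕₚ.m≤n+m _ (x h) ⟩
      x h ℕ.+ x k ℕ.* v h   ≡⟨ substitute-h x ⟨
      substitute k v x h    ≤⟨ below (substitute k v x) (T-substitute {v = v} {h} total-v (0<vh X) Tx) (tight-tie⁻ x tx) ⟩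
      t h                   ≡⟨ uses-h ⟨
      b ℕ.* v h             ∎)
      where open ℕₚ.≤-Reasoning

    collinear′ : ∀ x → T x → Tight tie x → (∀ g → x h ℕ.* s g ≡ x h ℕ.* t g) →
                 t′ k ⊗ x ⊕ x k ⊗ s ≗ t′ k ⊗ s ⊕ x k ⊗ t′
    collinear′ x Tx tx xhs≡xht g rewrite t′k≡b with g ≟ k
    ... | yes ≡.refl = begin
      b ℕ.* x k ℕ.+ x k ℕ.* s k   ≡⟨ ≡.cong (λ n → b ℕ.* x k ℕ.+ x k ℕ.* n) sk≡0 ⟩
      b ℕ.* x k ℕ.+ x k ℕ.* 0     ≡⟨ swap b (x k) ⟩
      b ℕ.* 0 ℕ.+ x k ℕ.* b       ≡⟨ ≡.cong₂ (λ m n → b ℕ.* m ℕ.+ x k ℕ.* n) sk≡0 t′k≡b ⟨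
      b ℕ.* s k ℕ.+ x k ℕ.* t′ k  ∎
      where
      open ≡-Reasoning
      swap : ∀ b l → b ℕ.* l ℕ.+ l ℕ.* 0 ≡ b ℕ.* 0 ℕ.+ l ℕ.* b
      swap = solve-∀
    ... | no g≢k = cancel-collinear {b} {v h} {x g} {x h} {x k} {v g} (0<vh X) (t′-other g≢k) (xhs≡xht g)
      (begin
        b ℕ.* v h ℕ.* (x g ℕ.+ x k ℕ.* v g) ℕ.+ (x h ℕ.+ x k ℕ.* v h) ℕ.* s g
          ≡⟨ ≡.cong₂ ℕ._+_ (≡.cong₂ ℕ._*_ uses-h (≡.cong (ℕ._+ x k ℕ.* v g) (≡.sym (erase-other x g≢k))))
               (≡.cong (ℕ._* s g) (≡.sym (substitute-h x))) ⟩
        t h ℕ.* x′ g ℕ.+ x′ h ℕ.* s g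
          ≡⟨ collinear x′ (T-substitute {v = v} {h} total-v (0<vh X) Tx) (tight-tie⁻ x tx) g ⟩
        t h ℕ.* s g ℕ.+ x′ h ℕ.* t g
          ≡⟨ ≡.cong₂ (λ m n → m ℕ.* s g ℕ.+ n ℕ.* t g) uses-h (≡.sym (substitute-h x)) ⟨
        b ℕ.* v h ℕ.* s g ℕ.+ (x h ℕ.+ x k ℕ.* v h) ℕ.* t g ∎)
      where
      open ≡-Reasoning
      x′ = substitute k v x

  -- The edge out of `t` is cut down to its far end by a penalty on `h`. Each vector of the chain
  -- thus gets a functional of its own and can serve as a new source.
  Vertex-step : ∀ {h t k t′} → Vertex t → Exchange h t k t′ → Vertex t′
  Vertex-step {h} {t} {k} {t′} V X = record
    { face    = raise
    ; T-t     = T-t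
    ; tight-t = tight-raise⁺ t′ tight-t t′h≡0
    ; unique  = λ x Tx tx → let tx′ , xh≡0 = tight-raise⁻ Tx tx in only-t′ x xh≡0 (collinear x Tx tx′)
    }
    where
    edge : Edge t t′ k
    edge = Span⇒Edge (Vertex⇒Span V h) (inj₁ (λ _ → ≡.refl)) X
    open Edge edge
    open Span span
    open Exchange X using () renaming (0<th to 0<h)
    open Fresh X sh≡0 using (t′h≡0)
    open Raise face h
    only-t′ : ∀ x → x h ≡ 0 → t′ k ⊗ x ⊕ x k ⊗ t ≗ t′ k ⊗ t ⊕ x k ⊗ t′ → x ≗ t′
    only-t′ x xh≡0 col g = ℕₚ.*-cancelˡ-≡ (x g) (t′ g) (t′ k) {{ℕ.>-nonZero 0<th}}
      (ℕₚ.+-cancelʳ-≡ (x k ℕ.* t g) _ _ (begin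
        t′ k ℕ.* x g ℕ.+ x k ℕ.* t g   ≡⟨ col g ⟩
        t′ k ℕ.* t g ℕ.+ x k ℕ.* t′ g  ≡⟨ ≡.cong₂ (λ m n → m ℕ.* t g ℕ.+ n ℕ.* t′ g) (≡.sym xk≡t′k) xk≡t′k ⟩
        x k ℕ.* t g ℕ.+ t′ k ℕ.* t′ g  ≡⟨ ℕₚ.+-comm (x k ℕ.* t g) _ ⟩
        t′ k ℕ.* t′ g ℕ.+ x k ℕ.* t g  ∎))
      where
      open ≡-Reasoning
      -- At the coordinate `h` both `x` and `t′` vanish while `t` does not, which forces the
      -- parameter `x k / t′ k` to be 1.
      xk≡t′k : x k ≡ t′ k
      xk≡t′k = ℕₚ.*-cancelʳ-≡ (x k) (t′ k) (t h) {{ℕ.>-nonZero 0<h}} (begin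
        x k ℕ.* t h                    ≡⟨ ≡.cong (ℕ._+ x k ℕ.* t h) (ℕₚ.*-zeroʳ (t′ k)) ⟨
        t′ k ℕ.* 0 ℕ.+ x k ℕ.* t h     ≡⟨ ≡.cong (λ n → t′ k ℕ.* n ℕ.+ x k ℕ.* t h) xh≡0 ⟨
        t′ k ℕ.* x h ℕ.+ x k ℕ.* t h   ≡⟨ col h ⟩
        t′ k ℕ.* t h ℕ.+ x k ℕ.* t′ h  ≡⟨ ≡.cong (λ n → t′ k ℕ.* t h ℕ.+ x k ℕ.* n) t′h≡0 ⟩
        t′ k ℕ.* t h ℕ.+ x k ℕ.* 0     ≡⟨ ≡.cong (t′ k ℕ.* t h ℕ.+_) (ℕₚ.*-zeroʳ (x k)) ⟩
        t′ k ℕ.* t h ℕ.+ 0             ≡⟨ ℕₚ.+-identityʳ _ ⟩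
        t′ k ℕ.* t h                   ∎)

-- Both kinds of operation as exchanges.

module ExchangeProperties {c ℓ₁ ℓ₂ a} (ℝ : RealNumbers c ℓ₁ ℓ₂) (G : FiniteAbelianGroup a)
                          (g₀ : FiniteAbelianGroup.Carrier G) where

  open RealProperties ℝ
  open GroupProperties G
  open MasterCorner ℝ G g₀
  open CornerProperties ℝ G g₀
  open AbelianGroup (FiniteAbelianGroup.abelianGroup G) using (group)
  open GroupLemmas group using (identityʳ-unique; identityˡ-unique)

  -- `μ₂` merges `t h` pairs of `h` and `f`; `μ₁` merges all copies of `h` at once, a single time.
  -- Each new element replaces at least two old ones, in the second case because `t h` exceeds 1.
  Operation⇒Exchange : ∀ ν {t t′} → Applicable ν t → Result ν t t′ →
    ∃[ k ] value k ≡ new ν t × Exchange (leading ν) t k t′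
  Operation⇒Exchange (μ₂ h f) {t} {t′} (_ , h≢f , 0<th , _ , th≤tf , k≢ε) (t′h , t′f , t′k , t′g) =
    k , ≡.refl , record
      { merged  = single h ⊕ single f
      ; times   = t h
      ; total-v = ≡.trans (Group.eval-⊕ value (single h) (single f))
                    (≡.cong₂ _∙_ (Group.eval-single value h) (Group.eval-single value f))
      ; size-v  = ℕₚ.≤-reflexive (≡.sym (≡.trans (size-⊕ (single h) (single f))
                    (≡.cong₂ ℕ._+_ (size-single h) (size-single f))))
      ; 0<times = 0<th
      ; 0<th    = 0<th
      ; uses-h  = ≡.trans (≡.cong₂ (λ m n → t h ℕ.* (m ℕ.+ n)) (single-same h) (single-other h≢f))
                    (ℕₚ.*-identityʳ (t h))
      ; fits    = fits
      ; result  = result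
      }
    where
    k : G⁺
    k = value h ∙ value f , [ k≢ε ]
    h≢k : h ≢ k
    h≢k h≡k = value≢ε f (identityʳ-unique (value h) (value f) (≡.sym (≡.cong value h≡k)))
    f≢k : f ≢ k
    f≢k f≡k = value≢ε h (identityˡ-unique (value h) (value f) (≡.sym (≡.cong value f≡k)))
    fits : ∀ g → t h ℕ.* (single h g ℕ.+ single f g) ℕ.≤ t g
    fits g with g ≟ h | g ≟ f
    ... | yes ≡.refl | yes h≡f    = contradiction h≡f h≢f
    ... | yes ≡.refl | no  _      = ℕₚ.≤-reflexive (ℕₚ.*-identityʳ (t g))
    ... | no  _      | yes ≡.refl = ≡.subst (ℕ._≤ t g) (≡.sym (ℕₚ.*-identityʳ (t h))) th≤tf
    ... | no  _      | no  _      = ≡.subst (ℕ._≤ t g) (≡.sym (ℕₚ.*-zeroʳ (t h))) z≤n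
    result : t′ ⊕ t h ⊗ (single h ⊕ single f) ≗ t ⊕ t h ⊗ single k
    result g with g ≟ h | g ≟ f | g ≟ k
    ... | yes ≡.refl | yes h≡f    | _          = contradiction h≡f h≢f
    ... | yes ≡.refl | _          | yes h≡k    = contradiction h≡k h≢k
    ... | _          | yes ≡.refl | yes f≡k    = contradiction f≡k f≢k
    ... | yes ≡.refl | no  _      | no  _
      rewrite t′h | ℕₚ.*-identityʳ (t g) | ℕₚ.*-zeroʳ (t g) = ≡.sym (ℕₚ.+-identityʳ (t g))
    ... | no  _      | yes ≡.refl | no  _
      rewrite t′f | ℕₚ.*-identityʳ (t h) | ℕₚ.*-zeroʳ (t h) =
        ≡.trans (ℕₚ.m∸n+n≡m th≤tf) (≡.sym (ℕₚ.+-identityʳ (t g)))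
    ... | no  _      | no  _      | yes ≡.refl
      rewrite t′k g ≡.refl | ℕₚ.*-identityʳ (t h) | ℕₚ.*-zeroʳ (t h) = ℕₚ.+-identityʳ _
    ... | no  g≢h    | no  g≢f    | no  g≢k
      rewrite t′g g g≢h g≢f (g≢k ∘ value-injective) | ℕₚ.*-zeroʳ (t h) = ≡.refl
  Operation⇒Exchange (μ₁ h) {t} {t′} (_ , 1<th , k≢ε) (t′h , t′k , t′g) =
    k , ≡.refl , record
      { merged  = t h ⊗ single h
      ; times   = 1
      ; total-v = ≡.trans (Group.eval-⊗ value (t h) (single h)) (≡.cong (t h ·_) (Group.eval-single value h))
      ; size-v  = ≡.subst (2 ℕ.≤_) (≡.sym (≡.trans (size-⊗ (t h) (single h))
                    (≡.trans (≡.cong (t h ℕ.*_) (size-single h)) (ℕₚ.*-identityʳ (t h))))) 1<th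
      ; 0<times = s≤s z≤n
      ; 0<th    = ℕₚ.<⇒≤ 1<th
      ; uses-h  = ≡.trans (ℕₚ.*-identityˡ _)
                    (≡.trans (≡.cong (t h ℕ.*_) (single-same h)) (ℕₚ.*-identityʳ (t h)))
      ; fits    = fits
      ; result  = result
      }
    where
    k : G⁺
    k = t h · value h , [ k≢ε ]
    -- If t h · h = h then the defining equations of the operation would contradict each other.
    h≢k : h ≢ k
    h≢k h≡k = ℕₚ.<⇒≢ (ℕₚ.m≤n+m 1 (t h)) (≡.trans (≡.sym t′h) (t′k h (≡.cong value h≡k)))
    fits : ∀ g → 1 ℕ.* (t h ℕ.* single h g) ℕ.≤ t g
    fits g with g ≟ h
    ... | yes ≡.refl = ℕₚ.≤-reflexive (≡.trans (ℕₚ.*-identityˡ _) (ℕₚ.*-identityʳ (t g)))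
    ... | no  _      = ≡.subst (ℕ._≤ t g) (≡.sym (≡.trans (ℕₚ.*-identityˡ _) (ℕₚ.*-zeroʳ (t h)))) z≤n
    result : t′ ⊕ 1 ⊗ (t h ⊗ single h) ≗ t ⊕ 1 ⊗ single k
    result g with g ≟ h | g ≟ k
    ... | yes ≡.refl | yes h≡k    = contradiction h≡k h≢k
    ... | yes ≡.refl | no  _
      rewrite t′h | ℕₚ.*-identityʳ (t g) = ≡.refl
    ... | no  _      | yes ≡.refl
      rewrite t′k g ≡.refl | ℕₚ.*-zeroʳ (t h) = ℕₚ.+-identityʳ _
    ... | no  g≢h    | no  g≢k
      rewrite t′g g g≢h (g≢k ∘ value-injective) | ℕₚ.*-zeroʳ (t h) = ≡.refl

-- Passage from `T` to its convex hull.

module Polyhedron {c ℓ₁ ℓ₂ a} (ℝ : RealNumbers c ℓ₁ ℓ₂) (G : FiniteAbelianGroup a)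
                  (g₀ : FiniteAbelianGroup.Carrier G) where

  open RealProperties ℝ
  open MasterCorner ℝ G g₀
  open CornerProperties ℝ G g₀
  open Mult semiring using (×-comm-*; ×-congʳ)
  open Sum semiring using (sum-cong-≋; ∑-distrib-+; *-distribʳ-sum; *-distribˡ-sum)
  open CommutativeSemigroupLemmas (CommutativeRing.*-commutativeSemigroup ring) using (x∙yz≈y∙xz)
  open GroupLemmas (CommutativeRing.+-group ring) using () renaming (∙-cancelʳ to +-cancelʳ)
  open SetoidReasoning setoid
  open Inequality

  ⟨⟩-embed : ∀ u x → ⟨ u , embed x ⟩ ≈ Real.eval u x
  ⟨⟩-embed u x = sum-cong-≋ {order⁺} λ i →
    trans (×-comm-* (x (element⁺ i)) (u (element⁺ i)) 1#) (×-congʳ (x (element⁺ i)) (*-identityʳ _))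

  -- Compatibility is demanded exactly for weights of sum 1, the combinations that occur in `conv`;
  -- constants therefore qualify.
  record Affine (φ : Point → R) : Set (a ⊔ c ⊔ ℓ₁) where
    field
      cong    : ∀ {x y} → x ≈ᵖ y → φ x ≈ φ y
      combine : ∀ {n} (w : Fin n → R) p → ∑ w ≈ 1# → φ (combination w p) ≈ ∑ (λ i → w i * φ (p i))

  open Affine

  affine-const : ∀ r → Affine (const r)
  affine-const r .cong _ = refl
  affine-const r .combine w p ∑w≈1 = begin
    r                     ≈⟨ *-identityˡ r ⟨
    1# * r                ≈⟨ *-congʳ ∑w≈1 ⟨
    ∑ w * r               ≈⟨ *-distribʳ-sum r w ⟩
    ∑ (λ i → w i * r)     ∎

  affine-coord : ∀ g → Affine (λ x → x g)
  affine-coord g .cong x≈y = x≈y g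
  affine-coord g .combine w p _ = refl

  affine-+ : ∀ {φ ψ} → Affine φ → Affine ψ → Affine (λ x → φ x + ψ x)
  affine-+ A B .cong x≈y = +-cong (cong A x≈y) (cong B x≈y)
  affine-+ {φ} {ψ} A B .combine {n} w p ∑w≈1 = begin
    φ (combination w p) + ψ (combination w p)
      ≈⟨ +-cong (combine A w p ∑w≈1) (combine B w p ∑w≈1) ⟩
    ∑ (λ i → w i * φ (p i)) + ∑ (λ i → w i * ψ (p i))
      ≈⟨ ∑-distrib-+ {n} _ _ ⟨
    ∑ (λ i → w i * φ (p i) + w i * ψ (p i))
      ≈⟨ sum-cong-≋ {n} (λ i → distribˡ (w i) (φ (p i)) (ψ (p i))) ⟨
    ∑ (λ i → w i * (φ (p i) + ψ (p i))) ∎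

  affine-*ˡ : ∀ {φ} r → Affine φ → Affine (λ x → r * φ x)
  affine-*ˡ r A .cong x≈y = *-congˡ (cong A x≈y)
  affine-*ˡ {φ} r A .combine {n} w p ∑w≈1 = begin
    r * φ (combination w p)          ≈⟨ *-congˡ (combine A w p ∑w≈1) ⟩
    r * ∑ (λ i → w i * φ (p i))      ≈⟨ *-distribˡ-sum {n} r _ ⟩
    ∑ (λ i → r * (w i * φ (p i)))    ≈⟨ sum-cong-≋ {n} (λ i → x∙yz≈y∙xz r (w i) (φ (p i))) ⟩
    ∑ (λ i → w i * (r * φ (p i)))    ∎

  affine-*ʳ : ∀ {φ} r → Affine φ → Affine (λ x → φ x * r)
  affine-*ʳ {φ} r A .cong x≈y = *-congʳ (cong A x≈y)
  affine-*ʳ {φ} r A .combine {n} w p ∑w≈1 = trans (*-comm _ r) (trans (combine (affine-*ˡ r A) w p ∑w≈1)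
    (sum-cong-≋ {n} (λ i → *-congˡ (*-comm r (φ (p i))))))

  affine-∑ : ∀ {m} {φ : Fin m → Point → R} → (∀ i → Affine (φ i)) → Affine (λ x → ∑ (λ i → φ i x))
  affine-∑ {zero}  A = affine-const 0#
  affine-∑ {suc m} A = affine-+ (A zero) (affine-∑ (A ∘ fsuc))

  affine-⟨⟩ : ∀ u → Affine ⟨ u ,_⟩
  affine-⟨⟩ u = affine-∑ {order⁺} (λ i → affine-*ˡ (u (element⁺ i)) (affine-coord (element⁺ i)))

  P-resp : ∀ {x y} → x ≈ᵖ y → x ∈ P → y ∈ P
  P-resp x≈y (n , p , w , p∈T , 0≤w , ∑w≈1 , x≈) =
    n , p , w , p∈T , 0≤w , ∑w≈1 , λ g → trans (sym (x≈y g)) (x≈ g)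

  T⊆P : ∀ {t} → T t → embed t ∈ P
  T⊆P {t} Tt = 1 , const (embed t) , const 1# , const (t , Tt , λ _ → refl) , const (<⇒≤ 0<1) ,
    +-identityʳ 1# , λ g → sym (trans (+-identityʳ _) (*-identityˡ _))

  P-≤ : ∀ {φ ψ} → Affine φ → Affine ψ → (∀ x → T x → φ (embed x) ≤ ψ (embed x)) →
        ∀ {y} → y ∈ P → φ y ≤ ψ y
  P-≤ A B φ≤ψ (n , p , w , p∈T , 0≤w , ∑w≈1 , y≈) = ≤-resp
    (sym (trans (cong A y≈) (combine A w p ∑w≈1))) (sym (trans (cong B y≈) (combine B w p ∑w≈1)))
    (∑-mono-≤ λ i → let x , Tx , p≈x = p∈T i in
      *-monoˡ-≤ (0≤w i) (≤-resp (sym (cong A p≈x)) (sym (cong B p≈x)) (φ≤ψ x Tx)))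

  module _ (F : Inequality) where

    valid-P : ∀ y → y ∈ P → bound F ≤ ⟨ coeff F , y ⟩
    valid-P y = P-≤ (affine-const (bound F)) (affine-⟨⟩ (coeff F))
      (λ x Tx → ≤-resp refl (sym (⟨⟩-embed (coeff F) x)) (valid F x Tx))

    -- At a point of the face the weighted slacks of the generators sum to zero. Being nonnegative,
    -- each of them vanishes, so a generator counts only where its slack is zero, that is, where it
    -- is tight.
    face-≤ : ∀ {φ ψ} → Affine φ → Affine ψ → (∀ x → T x → Tight F x → φ (embed x) ≤ ψ (embed x)) →
             ∀ {y} → y ∈ P → ⟨ coeff F , y ⟩ ≈ bound F → φ y ≤ ψ y
    face-≤ {φ} {ψ} A B φ≤ψ {y} y∈P@(n , p , w , p∈T , 0≤w , ∑w≈1 , y≈) y-tight = ≤-resp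
      (sym (trans (cong A y≈) (combine A w p ∑w≈1))) (sym (trans (cong B y≈) (combine B w p ∑w≈1)))
      (∑-mono-≤ λ i → weighted-≤ (0≤w i) (∑≈0⇒≈0 0≤wθ ∑wθ≈0 i) (on-face i))
      where
      θ : Point → R
      θ x = ⟨ coeff F , x ⟩ - bound F
      Θ : Affine θ
      Θ = affine-+ (affine-⟨⟩ (coeff F)) (affine-const (- bound F))
      0≤wθ : ∀ i → 0# ≤ w i * θ (p i)
      0≤wθ i = *-nonneg (0≤w i) (x≤y⇒0≤y-x (valid-P (p i) (let x , Tx , p≈x = p∈T i in
        P-resp (λ g → sym (p≈x g)) (T⊆P Tx))))
      ∑wθ≈0 : ∑ (λ i → w i * θ (p i)) ≈ 0#
      ∑wθ≈0 = trans (sym (trans (cong Θ y≈) (combine Θ w p ∑w≈1)))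
        (trans (+-congʳ y-tight) (-‿inverseʳ (bound F)))
      on-face : ∀ i → θ (p i) ≈ 0# → φ (p i) ≤ ψ (p i)
      on-face i θ≈0 = let x , Tx , p≈x = p∈T i in
        ≤-resp (sym (cong A p≈x)) (sym (cong B p≈x)) (φ≤ψ x Tx (begin
          Real.eval (coeff F) x      ≈⟨ ⟨⟩-embed (coeff F) x ⟨
          ⟨ coeff F , embed x ⟩      ≈⟨ cong (affine-⟨⟩ (coeff F)) p≈x ⟨
          ⟨ coeff F , p i ⟩          ≈⟨ x-y≈0⇒x≈y _ _ θ≈0 ⟩
          bound F                    ∎))

    face-≈ : ∀ {φ ψ} → Affine φ → Affine ψ → (∀ x → T x → Tight F x → φ (embed x) ≈ ψ (embed x)) →
             ∀ {y} → y ∈ P → ⟨ coeff F , y ⟩ ≈ bound F → φ y ≈ ψ y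
    face-≈ A B φ≈ψ y∈P y-tight = ≤-antisym
      (face-≤ A B (λ x Tx tx → ≤-reflexive (φ≈ψ x Tx tx)) y∈P y-tight)
      (face-≤ B A (λ x Tx tx → ≤-reflexive (sym (φ≈ψ x Tx tx))) y∈P y-tight)

  IsVertex⇒Vertex : ∀ {t} → T t → IsVertex P (embed t) → Vertex t
  IsVertex⇒Vertex {t} Tt ((u , δ , u-valid , to , from) , _) = record
    { face = record
      { coeff = u
      ; bound = δ
      ; valid = λ x Tx → ≤-resp refl (⟨⟩-embed u x) (u-valid (embed x) (T⊆P Tx))
      }
    ; T-t     = Tt
    ; tight-t = trans (sym (⟨⟩-embed u t)) (proj₂ (to {embed t} (λ _ → refl)))
    ; unique  = λ x Tx tx g → fromℕ-injective (x g) (t g)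
                  (from {embed x} (T⊆P Tx , trans (⟨⟩-embed u x) tx) g)
    }

  Vertex⇒IsVertex : ∀ {t} → Vertex t → IsVertex P (embed t)
  Vertex⇒IsVertex {t} V =
    (coeff face , bound face , valid-P face ,
      (λ y≈t → P-resp (λ g → sym (y≈t g)) (T⊆P T-t) ,
        trans (cong (affine-⟨⟩ (coeff face)) y≈t) (trans (⟨⟩-embed (coeff face) t) tight-t)) ,
      (λ (y∈P , y-tight) g → face-≈ face (affine-coord g) (affine-const (fromℕ (t g)))
        (λ x Tx tx → reflexive (≡.cong fromℕ (unique x Tx tx g))) y∈P y-tight)) ,
    const (embed t) , (λ _ _ → refl) ,
    (λ { w ∑w≈0 _ zero → trans (sym (+-identityʳ (w zero))) ∑w≈0 }) ,
    λ x x≈t → const 1# , +-identityʳ 1# , λ g → trans (x≈t g) (sym (trans (+-identityʳ _) (*-identityˡ _)))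
    where open Vertex V

  -- Segments as one-dimensional faces.

  endpoints : Point → Point → Fin 2 → Point
  endpoints x y zero     = x
  endpoints x y (fsuc _) = y

  weights : R → Fin 2 → R
  weights r zero     = 1# - r
  weights r (fsuc _) = r

  ∑-weights : ∀ r → ∑ (weights r) ≈ 1#
  ∑-weights r = trans (+-congˡ (+-identityʳ r)) (x-y+y≈x 1# r)

  complement : ∀ r x → (1# - r) * x + r * x ≈ x
  complement r x = trans (sym (distribʳ x (1# - r) r)) (trans (*-congʳ (x-y+y≈x 1# r)) (*-identityˡ x))

  segment-combination : ∀ {x y z r} → (z ≈ᵖ λ g → (1# - r) * x g + r * y g) →
                        z ≈ᵖ combination (weights r) (endpoints x y)
  segment-combination z≈ g = trans (z≈ g) (+-congˡ (sym (+-identityʳ _)))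

  module _ {s t h} (E : Edge s t h) where
    open Edge E
    open Span span

    private
      u = coeff face
      δ = bound face
      β = fromℕ (t h)
      β⁻¹ = proj₁ (inverse (fromℕ#0 0<th))

      β⁻¹β≈1 : β⁻¹ * β ≈ 1#
      β⁻¹β≈1 = proj₂ (inverse (fromℕ#0 0<th))

      0≤β⁻¹ : 0# ≤ β⁻¹
      0≤β⁻¹ β⁻¹<0 = ≤-resp (trans (*-comm β β⁻¹) β⁻¹β≈1) (zeroʳ β)
        (*-monoˡ-≤ (0≤fromℕ (t h)) (<⇒≤ β⁻¹<0)) 0<1

    segment⇒face : ∀ {z} → z ∈ segment (embed s) (embed t) → z ∈ P × ⟨ u , z ⟩ ≈ δ
    segment⇒face {z} (r , 0≤r , r≤1 , z≈) =
      (2 , p , weights r , p∈T , 0≤weights , ∑-weights r , z≈′) , (begin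
        ⟨ u , z ⟩                                 ≈⟨ cong (affine-⟨⟩ u) z≈′ ⟩
        ⟨ u , combination (weights r) p ⟩         ≈⟨ combine (affine-⟨⟩ u) (weights r) p (∑-weights r) ⟩
        (1# - r) * ⟨ u , embed s ⟩ + (r * ⟨ u , embed t ⟩ + 0#)
          ≈⟨ +-cong (*-congˡ (trans (⟨⟩-embed u s) tight-s))
               (trans (+-identityʳ _) (*-congˡ (trans (⟨⟩-embed u t) tight-t))) ⟩
        (1# - r) * δ + r * δ                      ≈⟨ complement r δ ⟩
        δ                                         ∎)
      where
      p = endpoints (embed s) (embed t)
      p∈T : ∀ i → ∃[ x ] T x × p i ≈ᵖ embed x
      p∈T zero     = s , T-s , λ _ → refl
      p∈T (fsuc _) = t , T-t , λ _ → refl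
      0≤weights : ∀ i → 0# ≤ weights r i
      0≤weights zero     = x≤y⇒0≤y-x r≤1
      0≤weights (fsuc _) = 0≤r
      z≈′ : z ≈ᵖ combination (weights r) p
      z≈′ = segment-combination {embed s} {embed t} z≈

    face⇒segment : ∀ {y} → y ∈ P → ⟨ u , y ⟩ ≈ δ → y ∈ segment (embed s) (embed t)
    face⇒segment {y} y∈P y-tight = r , 0≤r , r≤1 , y≈
      where
      -- The coordinate `h` runs from 0 at `s` to `t h` at `t`, so dividing by `t h` gives the
      -- parameter.
      r = β⁻¹ * y h
      0≤r : 0# ≤ r
      0≤r = *-nonneg 0≤β⁻¹ (P-≤ (affine-const 0#) (affine-coord h) (λ x _ → 0≤fromℕ (x h)) y∈P)
      r≤1 : r ≤ 1#
      r≤1 = ≤-resp refl β⁻¹β≈1 (*-monoˡ-≤ 0≤β⁻¹ (face-≤ face (affine-coord h) (affine-const β)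
        (λ x Tx tx → fromℕ-mono (below x Tx tx)) y∈P y-tight))
      fromℕ-comb : ∀ a b m n → fromℕ (a ℕ.* b ℕ.+ m ℕ.* n) ≈ fromℕ a * fromℕ b + fromℕ m * fromℕ n
      fromℕ-comb a b m n = trans (fromℕ-+ (a ℕ.* b) (m ℕ.* n)) (+-cong (fromℕ-* a b) (fromℕ-* m n))
      -- Both sides are affine in the point, so `collinear` extends from the tight points of `T` to
      -- the whole face.
      line : ∀ g → β * y g + y h * fromℕ (s g) ≈ β * fromℕ (s g) + y h * fromℕ (t g)
      line g = face-≈ face
        (affine-+ (affine-*ˡ β (affine-coord g)) (affine-*ʳ (fromℕ (s g)) (affine-coord h)))
        (affine-+ (affine-const (β * fromℕ (s g))) (affine-*ʳ (fromℕ (t g)) (affine-coord h)))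
        (λ x Tx tx → trans (sym (fromℕ-comb (t h) (x g) (x h) (s g)))
          (trans (reflexive (≡.cong fromℕ (collinear x Tx tx g))) (fromℕ-comb (t h) (s g) (x h) (t g))))
        y∈P y-tight
      normalise : ∀ p q v → β⁻¹ * (β * p + v * q) ≈ p + β⁻¹ * v * q
      normalise p q v = trans (distribˡ β⁻¹ (β * p) (v * q)) (+-cong
        (trans (sym (*-assoc β⁻¹ β p)) (trans (*-congʳ β⁻¹β≈1) (*-identityˡ p)))
        (sym (*-assoc β⁻¹ v q)))
      y≈ : y ≈ᵖ λ g → (1# - r) * fromℕ (s g) + r * fromℕ (t g)
      y≈ g = +-cancelʳ (r * S) _ _ (begin
        y g + r * S                        ≈⟨ normalise (y g) S (y h) ⟨
        β⁻¹ * (β * y g + y h * S)          ≈⟨ *-congˡ (line g) ⟩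
        β⁻¹ * (β * S + y h * U)            ≈⟨ normalise S U (y h) ⟩
        S + r * U                          ≈⟨ +-congʳ (complement r S) ⟨
        (1# - r) * S + r * S + r * U       ≈⟨ +-assoc _ _ _ ⟩
        (1# - r) * S + (r * S + r * U)     ≈⟨ +-congˡ (+-comm _ _) ⟩
        (1# - r) * S + (r * U + r * S)     ≈⟨ +-assoc _ _ _ ⟨
        (1# - r) * S + r * U + r * S       ∎)
        where
        S = fromℕ (s g)
        U = fromℕ (t g)

    edge-distinct : ¬ (embed s ≈ᵖ embed t)
    edge-distinct s≈t = ℕₚ.<⇒≢ 0<th (≡.trans (≡.sym sh≡0) (fromℕ-injective (s h) (t h) (s≈t h)))

    edge-dimension : HasDimension (segment (embed s) (embed t)) 1
    edge-dimension = endpoints (embed s) (embed t) , inside , independent ,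
      λ x (r , _ , _ , x≈) → weights r , ∑-weights r , segment-combination {embed s} {embed t} x≈
      where
      inside : ∀ i → endpoints (embed s) (embed t) i ∈ segment (embed s) (embed t)
      inside zero = 0# , ≤-reflexive refl , <⇒≤ 0<1 , λ g → sym (begin
        (1# - 0#) * fromℕ (s g) + 0# * fromℕ (t g)  ≈⟨ +-cong (*-congʳ (x-0≈x 1#)) (zeroˡ _) ⟩
        1# * fromℕ (s g) + 0#                       ≈⟨ +-identityʳ _ ⟩
        1# * fromℕ (s g)                            ≈⟨ *-identityˡ _ ⟩
        fromℕ (s g)                                 ∎)
      inside (fsuc _) = 1# , <⇒≤ 0<1 , ≤-reflexive refl , λ g → sym (begin
        (1# - 1#) * fromℕ (s g) + 1# * fromℕ (t g)  ≈⟨ +-cong (*-congʳ (-‿inverseʳ 1#)) (*-identityˡ _) ⟩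
        0# * fromℕ (s g) + fromℕ (t g)              ≈⟨ +-congʳ (zeroˡ _) ⟩
        0# + fromℕ (t g)                            ≈⟨ +-identityˡ _ ⟩
        fromℕ (t g)                                 ∎)
      independent : AffinelyIndependent (endpoints (embed s) (embed t))
      independent w ∑w≈0 comb≈0 = λ { zero → w₀≈0 ; (fsuc zero) → w₁≈0 }
        where
        w₀ = w zero
        w₁ = w (fsuc zero)
        -- In the coordinate `h` only `t` contributes to the vanishing combination.
        w₁≈0 : w₁ ≈ 0#
        w₁≈0 = *-cancel-# (fromℕ#0 0<th) (begin
          β * w₁                              ≈⟨ *-comm β w₁ ⟩
          w₁ * β                              ≈⟨ +-identityʳ _ ⟨
          w₁ * β + 0#                         ≈⟨ +-identityˡ _ ⟨
          0# + (w₁ * β + 0#)                  ≈⟨ +-congʳ (trans (*-congˡ (reflexive (≡.cong fromℕ sh≡0))) (zeroʳ w₀)) ⟨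
          w₀ * fromℕ (s h) + (w₁ * β + 0#)    ≈⟨ comb≈0 h ⟩
          0#                                  ≈⟨ zeroʳ β ⟨
          β * 0#                              ∎)
        w₀≈0 : w₀ ≈ 0#
        w₀≈0 = begin
          w₀                ≈⟨ +-identityʳ w₀ ⟨
          w₀ + 0#           ≈⟨ +-congˡ (trans (+-identityʳ w₁) w₁≈0) ⟨
          w₀ + (w₁ + 0#)    ≈⟨ ∑w≈0 ⟩
          0#                ∎

    Edge⇒face : IsFaceOfDimension P 1 (segment (embed s) (embed t))
    Edge⇒face = (u , δ , valid-P face , segment⇒face , λ (y∈P , y-tight) → face⇒segment y∈P y-tight) ,
      edge-dimension

  segment-swap : ∀ {x y z} → z ∈ segment x y → z ∈ segment y x
  segment-swap {x} {y} {z} (r , 0≤r , r≤1 , z≈) = 1# - r , x≤y⇒0≤y-x r≤1 ,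
    ≤-resp (+-identityˡ _) (x-y+y≈x 1# r) (+-cancel-0≤r) ,
    λ g → trans (z≈ g) (trans (+-comm _ _) (+-congʳ (*-congʳ (sym 1-[1-r]≈r))))
    where
    +-cancel-0≤r : 0# + (1# - r) ≤ 1# - r + r
    +-cancel-0≤r = ≤-resp refl (+-comm r (1# - r)) (+-monoʳ-≤ (1# - r) 0≤r)
    1-[1-r]≈r : 1# - (1# - r) ≈ r
    1-[1-r]≈r = +-cancelʳ (1# - r) _ _ (trans (x-y+y≈x 1# (1# - r)) (trans (sym (x-y+y≈x 1# r)) (+-comm _ _)))

  face-swap : ∀ {x y} → IsFaceOfDimension P 1 (segment x y) → IsFaceOfDimension P 1 (segment y x)
  face-swap {x} {y} ((u , δ , u-valid , to , from) , p , p∈F , indep , hull) =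
    (u , δ , u-valid , (λ {z} z∈ → to (segment-swap {y} {x} {z} z∈)) , λ {z} z∈ → segment-swap {x} {y} {z} (from z∈)) ,
    p , (λ i → segment-swap {x} {y} {p i} (p∈F i)) , indep , λ z z∈ → hull z (segment-swap {y} {x} {z} z∈)

-- Iteration along a chain of operations.

module Chains {c ℓ₁ ℓ₂ a} (ℝ : RealNumbers c ℓ₁ ℓ₂) (G : FiniteAbelianGroup a)
              (g₀ : FiniteAbelianGroup.Carrier G) where

  open GroupProperties G using (Multiset)
  open MasterCorner ℝ G g₀
  open CornerProperties ℝ G g₀
  open ExchangeProperties ℝ G g₀
  open Polyhedron ℝ G g₀

  Steps : ∀ {m} → (Fin (suc m) → Multiset) → (Fin m → Operation) → Set a
  Steps t ν = ∀ i → Applicable (ν i) (t (inject₁ i)) × Result (ν i) (t (inject₁ i)) (t (fsuc i))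

  Chained : ∀ {m} → (Fin (suc m) → Multiset) → (Fin m → Operation) → Set a
  Chained t ν = ∀ i j → toℕ j ≡ suc (toℕ i) → value (leading (ν j)) ≡ new (ν i) (t (inject₁ i))

  chained-tail : ∀ {m} (t : Fin (suc (suc m)) → Multiset) (ν : Fin (suc m) → Operation) →
                 Chained t ν → Chained (t ∘ fsuc) (ν ∘ fsuc)
  chained-tail t ν linked i j j≡1+i = linked (fsuc i) (fsuc j) (≡.cong suc j≡1+i)

  chain-vertices : ∀ {m} (t : Fin (suc m) → Multiset) ν → Steps t ν → Vertex (t zero) → ∀ i → Vertex (t i)
  chain-vertices t ν steps V zero = V
  chain-vertices {suc m} t ν steps V (fsuc i) with Operation⇒Exchange (ν zero) (steps zero .proj₁) (steps zero .proj₂)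
  ... | _ , _ , X = chain-vertices (t ∘ fsuc) (ν ∘ fsuc) (steps ∘ fsuc) (Vertex-step V X) i

  -- The source `s` stays fixed while the far end advances; the chain condition identifies the
  -- coordinate `k` of the edge just built with the leading element of the next operation.
  edges-from : ∀ {m s} (t : Fin (suc (suc m)) → Multiset) ν → Steps t ν → Chained t ν →
               Span s (t zero) (leading (ν zero)) → s ≗ t zero ⊎ s (leading (ν zero)) ≡ 0 →
               ∀ j → ∃[ k ] Edge s (t (fsuc j)) k
  edges-from t ν steps linked S cases j
    with Operation⇒Exchange (ν zero) (steps zero .proj₁) (steps zero .proj₂)
  edges-from t ν steps linked S cases zero | k , _ , X = k , Span⇒Edge S cases X
  edges-from {suc m} {s} t ν steps linked S cases (fsuc j) | k , k≡new , X =
    edges-from (t ∘ fsuc) (ν ∘ fsuc) (steps ∘ fsuc) (chained-tail t ν linked) span (inj₂ sh≡0) j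
    where
    k≡leading : k ≡ leading (ν (fsuc zero))
    k≡leading = value-injective (≡.trans k≡new (≡.sym (linked zero (fsuc zero) ≡.refl)))
    open Edge (≡.subst (Edge s (t (fsuc zero))) k≡leading (Span⇒Edge S cases X))

  edges-from-start : ∀ {m} (t : Fin (suc (suc m)) → Multiset) ν → Steps t ν → Chained t ν →
                     Vertex (t zero) → ∀ j → ∃[ k ] Edge (t zero) (t (fsuc j)) k
  edges-from-start t ν steps linked V =
    edges-from t ν steps linked (Vertex⇒Span V (leading (ν zero))) (inj₁ λ _ → ≡.refl)

  Joined : Multiset → Multiset → Set _
  Joined x y = ¬ (embed x ≈ᵖ embed y) × IsFaceOfDimension P 1 (segment (embed x) (embed y))

  Edge⇒Joined : ∀ {s t h} → Edge s t h → Joined s t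
  Edge⇒Joined E = edge-distinct E , Edge⇒face E

  Joined-sym : ∀ s t → Joined s t → Joined t s
  Joined-sym s t (s≉t , face) =
    (λ t≈s → s≉t (λ g → RealProperties.sym ℝ (t≈s g))) , face-swap {embed s} {embed t} face

  -- For two positive indices the first vector is dropped and the chain restarted at its successor,
  -- which is again a vertex; reversed pairs follow by symmetry of segments.
  chain-joined : ∀ {m} (t : Fin (suc m) → Multiset) ν → Steps t ν → Chained t ν →
                 Vertex (t zero) → ∀ i j → i ≢ j → Joined (t i) (t j)
  chain-joined t ν steps linked V zero zero i≢j = contradiction ≡.refl i≢j
  chain-joined {suc m} t ν steps linked V zero (fsuc j) _ =
    Edge⇒Joined (edges-from-start t ν steps linked V j .proj₂)
  chain-joined {suc m} t ν steps linked V (fsuc i) zero _ =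
    Joined-sym (t zero) (t (fsuc i)) (Edge⇒Joined (edges-from-start t ν steps linked V i .proj₂))
  chain-joined {suc m} t ν steps linked V (fsuc i) (fsuc j) i≢j =
    chain-joined (t ∘ fsuc) (ν ∘ fsuc) (steps ∘ fsuc) (chained-tail t ν linked)
      (chain-vertices t ν steps V (fsuc zero)) i j (i≢j ∘ ≡.cong fsuc)

Applicable⇒T : ∀ {c ℓ₁ ℓ₂ a} (ℝ : RealNumbers c ℓ₁ ℓ₂) (G : FiniteAbelianGroup a)
    (g₀ : FiniteAbelianGroup.Carrier G) →
    let open MasterCorner ℝ G g₀ in ∀ ν {t} → Applicable ν t → T t
Applicable⇒T ℝ G g₀ (MasterCorner.μ₂ h f) = proj₁
Applicable⇒T ℝ G g₀ (MasterCorner.μ₁ h)   = proj₁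

open import Data.Nat.Base using (_≤_)

theorem6 : ∀ {c ℓ₁ ℓ₂ a} (ℝ : RealNumbers c ℓ₁ ℓ₂) (G : FiniteAbelianGroup a)
    (g₀ : FiniteAbelianGroup.Carrier G) →
    let open MasterCorner ℝ G g₀ in
    (m : ℕ) → 1 ≤ m →
    (t : Fin (suc m) → G⁺ → ℕ) (ν : Fin m → Operation) →
    IsVertex P (embed (t zero)) →
    (∀ i → Applicable (ν i) (t (inject₁ i)) × Result (ν i) (t (inject₁ i)) (t (fsuc i))) →
    (∀ i j → toℕ j ≡ suc (toℕ i) → value (leading (ν j)) ≡ new (ν i) (t (inject₁ i))) →
    (∀ i → IsVertex P (embed (t i))) ×
    (∀ i j → i ≢ j →
    ¬ (embed (t i) ≈ᵖ embed (t j)) × Adjacent P (embed (t i)) (embed (t j)))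
theorem6 ℝ G g₀ m@(suc _) 1≤m t ν t₀-vertex steps linked =
  vertices , λ i j i≢j → let i≉j , face = chain-joined t ν steps linked V i j i≢j in
    i≉j , vertices i , vertices j , face
  where
  open MasterCorner ℝ G g₀
  open CornerProperties ℝ G g₀
  open Polyhedron ℝ G g₀
  open Chains ℝ G g₀
  V : Vertex (t zero)
  -- Since `m` is positive there is a first operation, and its applicability places `t zero` in `T`.
  V = IsVertex⇒Vertex (Applicable⇒T ℝ G g₀ (ν zero) (steps zero .proj₁)) t₀-vertex
  vertices : ∀ i → IsVertex P (embed (t i))
  vertices i = Vertex⇒IsVertex (chain-vertices t ν steps V i)
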